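{- Let $k,n\ge 1$ and let $\bm{\beta}/\bm{\gamma}=(\beta^{(1)}/\gamma^{(1)},\ldots,\beta^{(k)}/\gamma^{(k)})$ be a tuple of skew partitions (each $\beta^{(j)}$ and $\gamma^{(j)}$ having the same number $p_j\ge 1$ of parts, with $\gamma^{(j)}_m\le\beta^{(j)}_m$ for all $m$). Then the partition function of the lattice $L_{\bm{\beta}/\bm{\gamma}}$ equals the coinversion LLT polynomial: \[\mathcal{Z}_{\bm{\beta}/\bm{\gamma}}(x_1,\ldots,x_n;t)=\mathcal{L}_{\bm{\beta}/\bm{\gamma}}(x_1,\ldots,x_n;t).\]
   Context: Partitions have a fixed number of parts, zero parts allowed. Cells are pairs $(r,c)\in\mathbb{Z}\times\mathbb{Z}$ (row $r$, column $c$; French convention, rows numbered bottom to top). The skew shape $\beta^{(a)}/\gamma^{(a)}$ consists of the cells $(r,c)$ with $1\le r\le p_a$ and $\gamma^{(a)}_r<c\le\beta^{(a)}_r$. The content of $(r,c)$ is $c-r$. A semistandard tableau $T=(T^{(1)},\ldots,T^{(k)})$ of shape $\bm{\beta}/\bm{\gamma}$ with entries in $[n]$ fills each $\beta^{(a)}/\gamma^{(a)}$ with elements of $\{1,\ldots,n\}$, weakly increasing along rows (left to right) and strictly increasing up columns; $x^T=\prod_{\text{cells }u}x_{T(u)}$. A triple is $(u,v,w)$ where for some $a<b$: $v$ is a cell of $\beta^{(a)}/\gamma^{(a)}$, and $u=(r,c-1)$, $w=(r,c)$ for some $1\le r\le p_b$ with $w$ of the same content as $v$, $\gamma^{(b)}_r\le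 c-1$ and $c\le\beta^{(b)}_r+1$. For a tableau $T$, let $b$ be the entry of $v$ in $T^{(a)}$, $a'$ the entry of $u$ in $T^{(b)}$ if $u\in\beta^{(b)}/\gamma^{(b)}$ and $a'=0$ otherwise, and $c'$ the entry of $w$ in $T^{(b)}$ if $w\in\beta^{(b)}/\gamma^{(b)}$ and $c'=\infty$ otherwise; the triple is a coinversion triple of $T$ if $a'\le b\le c'$. $\mathrm{coinv}(T)$ is the number of coinversion triples, and $\mathcal{L}_{\bm{\beta}/\bm{\gamma}}(x_1,\ldots,x_n;t)=\sum_T t^{\mathrm{coinv}(T)}x^T$, summed over semistandard tableaux of shape $\bm{\beta}/\bm{\gamma}$ with entries in $[n]$. Lattice model: for $\bm{I}\in\{0,1\}^k$ write $|\bm{I}|=\sum_m I_m$ and $\bm{I}_{[i,j]}=\sum_{m=i}^j I_m$ (empty sum $0$). A face with bottom, left, top, right edge labels $\bm{I},\bm{J},\bm{K},\bm{L}\in\{0,1\}^k$ and spectral parameter $x$ has weight $L_x(\bm{I},\bm{J};\bm{K},\bm{L})=x^{|\bm{L}|}\prod_{m:L_m=1}t^{\bm{I}_{[m+1,k]}+\bm{J}_{[m+1,k]}}$ if $\bm{I}+\bm{J}=\bm{K}+\bm{L}$ and there is no $i$ with $I_i=J_i=1$, and $0$ otherwise. For a tuple of partitions $\bm{\mu}=(\mu^{(1)},\ldots,\mu^{(k)})$, $\mu^{(j)}$ with $p_j$ parts, and $i\in\mathbb{Z}$, let $\bm{\mu}(i)\in\{0,1\}^k$ have $j$-th component $1$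 iff $i=\mu^{(j)}_m-m+1$ for some $1\le m\le p_j$. Let $r=\min\{i:\bm{\gamma}(i)\ne\mathbf 0\}$ and $s=\max\{i:\bm{\beta}(i)\ne\mathbf 0\}$. The lattice $L_{\bm{\beta}/\bm{\gamma}}$ has rows $1,\ldots,n$ (bottom to top) and columns $r,\ldots,s$; the face in row $e$ has weight $L_{x_e}$; the bottom boundary edge of column $p$ is labeled $\bm{\gamma}(p)$, the top boundary edge of column $p$ is labeled $\bm{\beta}(p)$, and all left and right boundary edges are labeled $\mathbf 0$. $\mathcal{Z}_{\bm{\beta}/\bm{\gamma}}(x_1,\ldots,x_n;t)$ is the sum over all labelings of the internal edges by elements of $\{0,1\}^k$ of the product of the face weights. -}

module Defs where

open import Level using (Level)
open import Algebra.Bundles using (CommutativeSemiring)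
open import Data.Bool using (Bool; true; false; if_then_else_; _∧_; _∨_; not)
open import Data.Nat as ℕ using (ℕ; zero; suc; _+_; _∸_; _≤ᵇ_; _<ᵇ_; _≡ᵇ_)
open import Data.Integer as ℤ using (ℤ; +_)
open import Data.Fin as Fin using (Fin; fromℕ<)
open import Data.Vec as Vec using (Vec; []; _∷_; tabulate)
open import Data.List as List using (List; []; _∷_; length; map; concatMap; upTo; allFin; foldr; filter)
open import Data.Product using (_×_; _,_)
open import Relation.Nullary.Decidable using (⌊_⌋; yes; no)
open import Relation.Binary.PropositionalEquality using (_≡_)

-- the m-th part (1-indexed) of a partition given as a list; 0 out of range
part : List ℕ → ℕ → ℕ
part []       _             = 0
part (x ∷ xs) zero          = 0
part (x ∷ xs) (suc zero)    = x
part (x ∷ xs) (suc (suc m)) = part xs (suc m)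

range : ℕ → ℕ → List ℕ
range lo hi = map (λ i → suc (lo + i)) (upTo (hi ∸ lo))

anyL : {A : Set} → (A → Bool) → List A → Bool
anyL f = foldr (λ a b → f a ∨ b) false

allL : {A : Set} → (A → Bool) → List A → Bool
allL f = foldr (λ a b → f a ∧ b) true

countL : {A : Set} → (A → Bool) → List A → ℕ
countL f = foldr (λ a n → if f a then suc n else n) 0

sumℕ : List ℕ → ℕ
sumℕ = foldr _+_ 0

b2n : Bool → ℕ
b2n true  = 1
b2n false = 0

allVecs : (k : ℕ) → List (Vec Bool k)
allVecs zero    = [] ∷ []
allVecs (suc k) = concatMap (λ v → (false ∷ v) ∷ (true ∷ v) ∷ []) (allVecs k)

allSeqs : (k N : ℕ) → List (List (Vec Bool k))
allSeqs k zero    = [] ∷ []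
allSeqs k (suc N) = concatMap (λ s → map (λ v → v ∷ s) (allVecs k)) (allSeqs k N)

eqB : Bool → Bool → Bool
eqB true  true  = true
eqB false false = true
eqB _     _     = false

eqV : ∀ {k} → Vec Bool k → Vec Bool k → Bool
eqV []       []       = true
eqV (a ∷ as) (b ∷ bs) = eqB a b ∧ eqV as bs

eqLV : ∀ {k} → List (Vec Bool k) → List (Vec Bool k) → Bool
eqLV []       []       = true
eqLV (a ∷ as) (b ∷ bs) = eqV a b ∧ eqLV as bs
eqLV _        _        = false

zeroV : ∀ k → Vec Bool k
zeroV k = Vec.replicate k false

cntV : ∀ {k} → Vec Bool k → ℕ
cntV []       = 0
cntV (b ∷ bs) = b2n b + cntV bs

-- Shapes.  A tuple of skew shapes β/γ is given by β γ : Fin k → List ℕ,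
-- the j-th partitions being β j and γ j (p_j = length (β j)).
-- Rows r are numbered 1..p_j, cells are pairs (r , c).

module Shape {k : ℕ} (β γ : Fin k → List ℕ) where

  p : Fin k → ℕ
  p a = length (β a)

  rows : Fin k → List ℕ
  rows a = map suc (upTo (p a))

  inShape : Fin k → ℕ → ℕ → Bool
  inShape a r c = (1 ≤ᵇ r) ∧ (r ≤ᵇ p a) ∧ (part (γ a) r <ᵇ c) ∧ (c ≤ᵇ part (β a) r)

  cells : Fin k → List (ℕ × ℕ)
  cells a = concatMap (λ r → map (λ c → (r , c)) (range (part (γ a) r) (part (β a) r))) (rows a)

  allCells : List (Fin k × ℕ × ℕ)
  allCells = concatMap (λ a → map (λ rc → (a , rc)) (cells a)) (allFin k)

  content : ℕ → ℕ → ℤ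
  content r c = + c ℤ.- + r

  -- a filling: T a r c is the entry of cell (r , c) of T^(a)
  Filling : Set
  Filling = Fin k → ℕ → ℕ → ℕ

  update : Filling → Fin k × ℕ × ℕ → ℕ → Filling
  update T (a , r , c) v a' r' c' =
    if ⌊ a' Fin.≟ a ⌋ ∧ (r' ≡ᵇ r) ∧ (c' ≡ᵇ c) then v else T a' r' c'

  semistandard : Filling → Bool
  semistandard T = allL ok allCells
    where
    ok : Fin k × ℕ × ℕ → Bool
    ok (a , r , c) =
      (not (inShape a r (suc c)) ∨ (T a r c ≤ᵇ T a r (suc c))) ∧
      (not (inShape a (suc r) c) ∨ (T a r c <ᵇ T a (suc r) c))

  -- the coinversion condition a' ≤ b ≤ c' for the triple (u , v , w)
  -- with v = (rv , cv) in component a, u = (r , c-1), w = (r , c) in component b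
  coinvCond : Filling → Fin k → ℕ → ℕ → Fin k → ℕ → ℕ → Bool
  coinvCond T a rv cv b r c =
    ((if inShape b r (c ∸ 1) then T b r (c ∸ 1) else 0) ≤ᵇ T a rv cv) ∧
    (if inShape b r c then T a rv cv ≤ᵇ T b r c else true)

  -- candidate columns c for w = (r , c) in component b:  γ_r ≤ c-1 and c ≤ β_r + 1
  wCols : Fin k → ℕ → List ℕ
  wCols b r = range (part (γ b) r) (suc (part (β b) r))

  coinv : Filling → ℕ
  coinv T =
    sumℕ (map (λ a → sumℕ (map (λ b →
      if ⌊ a Fin.<? b ⌋ then
        sumℕ (map (λ { (rv , cv) →
          sumℕ (map (λ r →
            countL (λ c → ⌊ content r c ℤ.≟ content rv cv ⌋ ∧ coinvCond T a rv cv b r c)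
                   (wCols b r)) (rows b)) }) (cells a))
      else 0) (allFin k))) (allFin k))

  label : (Fin k → List ℕ) → ℤ → Vec Bool k
  label μ i = tabulate λ j →
    anyL (λ m → ⌊ i ℤ.≟ (+ part (μ j) m ℤ.- + m ℤ.+ + 1) ⌋) (map suc (upTo (length (μ j))))

  positions : (Fin k → List ℕ) → List ℤ
  positions μ = concatMap (λ j → map (λ m → + part (μ j) m ℤ.- + m ℤ.+ + 1)
                                     (map suc (upTo (length (μ j))))) (allFin k)

  minℤ : List ℤ → ℤ
  minℤ []       = + 0
  minℤ (x ∷ xs) = foldr ℤ._⊓_ x xs

  maxℤ : List ℤ → ℤ
  maxℤ []       = + 0
  maxℤ (x ∷ xs) = foldr ℤ._⊔_ x xs

  -- r = min{ i : γ(i) ≠ 0 },  s = max{ i : β(i) ≠ 0 }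
  rmin smax : ℤ
  rmin = minℤ (positions γ)
  smax = maxℤ (positions β)

  columns : List ℤ
  columns = map (λ i → rmin ℤ.+ + i) (upTo (suc ℤ.∣ smax ℤ.- rmin ∣))

  bottomBoundary topBoundary : List (Vec Bool k)
  bottomBoundary = map (label γ) columns
  topBoundary    = map (label β) columns

module Weights {c ℓ : Level} (R : CommutativeSemiring c ℓ) where
  open CommutativeSemiring R using (Carrier; 0#; 1#) renaming (_+_ to _⊕_; _*_ to _⊛_)

  pow : Carrier → ℕ → Carrier
  pow x zero    = 1#
  pow x (suc m) = x ⊛ pow x m

  sumR : List Carrier → Carrier
  sumR = foldr _⊕_ 0#

  prodR : List Carrier → Carrier
  prodR = foldr _⊛_ 1#

  -- x_i for i ∈ [n] (entries are 1..n); 0 otherwise (never used)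
  xAt : ∀ {n} → (Fin n → Carrier) → ℕ → Carrier
  xAt {n} x zero    = 0#
  xAt {n} x (suc j) with j ℕ.<? n
  ... | yes j<n = x (fromℕ< j<n)
  ... | no  _   = 0#

  module LLT {k n : ℕ} (β γ : Fin k → List ℕ) (x : Fin n → Carrier) (t : Carrier) where
    open Shape β γ

    sumFill : List (Fin k × ℕ × ℕ) → (Filling → Carrier) → Filling → Carrier
    sumFill []         f T = f T
    sumFill (u ∷ us) f T = sumR (map (λ v → sumFill us f (update T u v)) (range 0 n))

    monomial : Filling → Carrier
    monomial T = prodR (map (λ { (a , r , c) → xAt x (T a r c) }) allCells)

    tableauWeight : Filling → Carrier
    tableauWeight T = if semistandard T then pow t (coinv T) ⊛ monomial T else 0#

    LLTpoly : Carrier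
    LLTpoly = sumFill allCells tableauWeight (λ _ _ _ → 0)

  okFace : ∀ {m} → Vec Bool m → Vec Bool m → Vec Bool m → Vec Bool m → Bool
  okFace []       []       []       []       = true
  okFace (i ∷ I) (j ∷ J) (k ∷ K) (l ∷ L) =
    (b2n i + b2n j ≡ᵇ b2n k + b2n l) ∧ not (i ∧ j) ∧ okFace I J K L

  texp : ∀ {m} → Vec Bool m → Vec Bool m → Vec Bool m → ℕ
  texp []       []       []       = 0
  texp (i ∷ I) (j ∷ J) (l ∷ L) = (if l then cntV I + cntV J else 0) + texp I J L

  -- L_x(I , J ; K , L)  (bottom, left, top, right)
  faceWeight : ∀ {k} → Carrier → Carrier → Vec Bool k → Vec Bool k → Vec Bool k → Vec Bool k → Carrier
  faceWeight x t I J K L = if okFace I J K L then pow x (cntV L) ⊛ pow t (texp I J L) else 0#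

  -- one row of the lattice: left edge label J, bottom labels, top labels;
  -- sums over the labels of the vertical (left/right) edges, right boundary 0
  rowWeight : ∀ {k} → Carrier → Carrier → Vec Bool k → List (Vec Bool k) → List (Vec Bool k) → Carrier
  rowWeight {k} x t J []       []       = if eqV J (zeroV k) then 1# else 0#
  rowWeight {k} x t J (I ∷ Is) (K ∷ Ks) =
    sumR (map (λ L → faceWeight x t I J K L ⊛ rowWeight x t L Is Ks) (allVecs k))
  rowWeight x t J _ _ = 0#

  -- rows with spectral parameters xs (bottom to top), bottom and top boundary;
  -- sums over the labels of the horizontal edges between consecutive rows
  latticeZ : ∀ {k} → Carrier → List Carrier → List (Vec Bool k) → List (Vec Bool k) → Carrier
  latticeZ {k} t []       bot top = if eqLV bot top then 1# else 0#
  latticeZ {k} t (x ∷ xs) bot top =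
    sumR (map (λ mid → rowWeight x t (zeroV k) bot mid ⊛ latticeZ t xs mid top)
              (allSeqs k (length bot)))

  partitionFunction : ∀ {k n} → (β γ : Fin k → List ℕ) → (Fin n → Carrier) → Carrier → Carrier
  partitionFunction {k} {n} β γ x t =
    latticeZ t (map x (allFin n)) (Shape.bottomBoundary β γ) (Shape.topBoundary β γ)

  coinvLLT : ∀ {k n} → (β γ : Fin k → List ℕ) → (Fin n → Carrier) → Carrier → Carrier
  coinvLLT β γ x t = LLT.LLTpoly β γ x t

{-# OPTIONS --safe #-}
module Submission where

-- For each colour a, both sides are described by the height function h e j, the number of particles
-- of colour a in the columns ≥ j after e rows.  A cell of content q becomes the right edge of column
-- q, and with entries extended by 0 to the left and ∞ to the right of the shape, the r-th row entry
-- over column j is ≤ e exactly when r ≤ h e j.  Under this correspondence a filling is semistandard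
-- iff h e (j + 1) ≤ h e j ≤ h (e + 1) j ≤ h e (j + 1) + 1, and these inequalities say exactly that
-- the four increments of h around each face are edge labels of nonzero weight.  For the weights: a
-- right edge of colour a in row e is a cell v with entry e, and a colour b > a enters the same face
-- iff some row of β⁽ᵇ⁾/γ⁽ᵇ⁾ has T(u) ≤ e ≤ T(w), so the exponent of t counts coinversion triples.

open import Defs
open import Level using (Level)
open import Algebra.Bundles using (CommutativeMonoid; CommutativeSemiring)
open import Agda.Builtin.Int using (pos; negsuc)
open import Data.Bool using (Bool; true; false; if_then_else_; _∧_; _∨_; not; T)
import Data.Bool.Properties as Bool
open import Data.Nat
open import Data.Nat.Properties
open import Data.Integer as ℤ using (ℤ)
import Data.Integer.Properties as ℤ
open import Algebra.Properties.AbelianGroup ℤ.+-0-abelianGroup using () renaming (∙-cancelˡ to ℤ-+-cancelˡ)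
open import Data.Fin as Fin using (Fin; zero; suc; toℕ; fromℕ<)
open import Data.Fin.Properties using (fromℕ<-toℕ; toℕ<n)
open import Data.Vec as Vec using (Vec; []; _∷_; lookup; tabulate)
open import Data.Vec.Properties as Vec using (lookup∘tabulate; tabulate-cong; lookup-replicate)
open import Data.List as List using (List; []; _∷_; _++_; foldr; map; concatMap; upTo; applyUpTo; length; allFin)
open import Data.List.Properties using (map-upTo; map-∘; map-cong; map-tabulate; length-applyUpTo; ≡-dec)
open import Data.List.Membership.Propositional using (_∈_; _∉_)
open import Data.List.Membership.Propositional.Properties using (∈-map⁻; ∈-map⁺; ∈-upTo⁺; ∈-upTo⁻; ∈-allFin; ∈-applyUpTo⁻)
open import Data.List.Relation.Binary.Pointwise using (Pointwise; []; _∷_; Pointwise-length)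
open import Data.List.Relation.Unary.Any using (here; there)
import Data.List.Relation.Unary.Any.Properties as AnyP
open import Data.List.Relation.Unary.All as All using (All; []; _∷_)
open import Data.List.Relation.Unary.AllPairs using ([]; _∷_)
open import Data.List.Relation.Unary.Linked using (Linked; []; [-]; _∷_)
open import Data.List.Relation.Unary.Unique.Propositional using (Unique)
import Data.List.Relation.Unary.Unique.Propositional.Properties as Unique
open import Data.Product using (_×_; _,_; proj₁; proj₂; ∃)
open import Data.Sum using (_⊎_; inj₁; inj₂)
open import Data.Empty using (⊥; ⊥-elim)
open import Data.Unit using (tt)
open import Function using (_∘_; id)
open import Relation.Binary.Definitions using (tri<; tri≈; tri>)
open import Relation.Binary.PropositionalEquality using (_≡_; _≢_; refl; sym; trans; cong; cong₂; subst; subst₂; module ≡-Reasoning)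
open import Relation.Nullary using (¬_; Dec; yes; no)
open import Relation.Nullary.Decidable using (⌊_⌋; isYes≗does; dec-true; dec-false)

∈-concatMap : ∀ {a b} {A : Set a} {B : Set b} (g : A → List B) {xs x y} →
  x ∈ xs → y ∈ g x → y ∈ concatMap g xs
∈-concatMap g (here refl) q = AnyP.++⁺ˡ q
∈-concatMap g {x′ ∷ xs} (there p) q = AnyP.++⁺ʳ (g x′) (∈-concatMap g p q)

∈-concatMap⁻ : ∀ {a b} {A : Set a} {B : Set b} (g : A → List B) xs {y} →
  y ∈ concatMap g xs → ∃ λ x → x ∈ xs × y ∈ g x
∈-concatMap⁻ g (x ∷ xs) p with AnyP.++⁻ (g x) p
... | inj₁ q = x , here refl , q
... | inj₂ q with ∈-concatMap⁻ g xs q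
...   | x′ , i , q′ = x′ , there i , q′

concatMap-unique : ∀ {a b} {A : Set a} {B : Set b} (g : A → List B) (back : B → A) {xs} →
  (∀ {x y} → y ∈ g x → back y ≡ x) → (∀ x → Unique (g x)) → Unique xs → Unique (concatMap g xs)
concatMap-unique g back b u [] = []
concatMap-unique g back {x ∷ xs} b u (x∉ ∷ ux) =
  Unique.++⁺ (u x) (concatMap-unique g back b u ux) disjoint
  where
  disjoint : ∀ {y} → y ∈ g x × y ∈ concatMap g xs → ⊥
  disjoint (p , q) with ∈-concatMap⁻ g xs q
  ... | x′ , x′∈ , q′ = All.lookup x∉ x′∈ (trans (sym (b p)) (b q′))

module BigOp {c ℓ : Level} (M : CommutativeMonoid c ℓ) where
  open CommutativeMonoid M renaming (refl to ≈-refl; sym to ≈-sym; trans to ≈-trans)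
  open import Relation.Binary.Reasoning.Setoid setoid
  open import Algebra.Properties.CommutativeSemigroup commutativeSemigroup using (interchange)

  ⨁ : ∀ {a} {A : Set a} → List A → (A → Carrier) → Carrier
  ⨁ xs f = foldr _∙_ ε (map f xs)

  ⨁-cong : ∀ {a} {A : Set a} (xs : List A) {f g : A → Carrier} →
    (∀ {x} → x ∈ xs → f x ≈ g x) → ⨁ xs f ≈ ⨁ xs g
  ⨁-cong []       eq = ≈-refl
  ⨁-cong (x ∷ xs) eq = ∙-cong (eq (here refl)) (⨁-cong xs (eq ∘ there))

  ⨁-ε : ∀ {a} {A : Set a} (xs : List A) {f : A → Carrier} →
    (∀ {x} → x ∈ xs → f x ≈ ε) → ⨁ xs f ≈ ε
  ⨁-ε []       eq = ≈-refl
  ⨁-ε (x ∷ xs) eq = ≈-trans (∙-cong (eq (here refl)) (⨁-ε xs (eq ∘ there))) (identityˡ ε)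

  ⨁-∙ : ∀ {a} {A : Set a} (xs : List A) (f g : A → Carrier) →
    ⨁ xs (λ x → f x ∙ g x) ≈ ⨁ xs f ∙ ⨁ xs g
  ⨁-∙ []       f g = ≈-sym (identityˡ ε)
  ⨁-∙ (x ∷ xs) f g = ≈-trans (∙-congˡ (⨁-∙ xs f g)) (interchange (f x) (g x) _ _)

  ⨁-swap : ∀ {a b} {A : Set a} {B : Set b} (xs : List A) (ys : List B) (f : A → B → Carrier) →
    ⨁ xs (λ x → ⨁ ys (f x)) ≈ ⨁ ys (λ y → ⨁ xs (λ x → f x y))
  ⨁-swap []       ys f = ≈-sym (⨁-ε ys (λ _ → ≈-refl))
  ⨁-swap (x ∷ xs) ys f = ≈-trans (∙-congˡ (⨁-swap xs ys f)) (≈-sym (⨁-∙ ys (f x) _))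

  ⨁-++ : ∀ {a} {A : Set a} (xs ys : List A) (f : A → Carrier) → ⨁ (xs ++ ys) f ≈ ⨁ xs f ∙ ⨁ ys f
  ⨁-++ []       ys f = ≈-sym (identityˡ _)
  ⨁-++ (x ∷ xs) ys f = ≈-trans (∙-congˡ (⨁-++ xs ys f)) (≈-sym (assoc _ _ _))

  ⨁-concatMap : ∀ {a b} {A : Set a} {B : Set b} (g : A → List B) (xs : List A) (f : B → Carrier) →
    ⨁ (concatMap g xs) f ≈ ⨁ xs (λ x → ⨁ (g x) f)
  ⨁-concatMap g []       f = ≈-refl
  ⨁-concatMap g (x ∷ xs) f = ≈-trans (⨁-++ (g x) _ f) (∙-congˡ (⨁-concatMap g xs f))

  ⨁-map : ∀ {a b} {A : Set a} {B : Set b} (g : A → B) (xs : List A) (f : B → Carrier) →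
    ⨁ (map g xs) f ≡ ⨁ xs (f ∘ g)
  ⨁-map g xs f = cong (foldr _∙_ ε) (sym (map-∘ xs))

  ⨁-upTo-suc : ∀ n (f : ℕ → Carrier) → ⨁ (upTo (suc n)) f ≡ f 0 ∙ ⨁ (upTo n) (f ∘ suc)
  ⨁-upTo-suc n f = cong (f 0 ∙_) (trans (cong (λ l → ⨁ l f) (sym (map-upTo suc n))) (⨁-map suc (upTo n) f))

  ⨁-single : ∀ {a} {A : Set a} {xs : List A} {x} {f : A → Carrier} → Unique xs → x ∈ xs →
    (∀ {y} → y ∈ xs → y ≢ x → f y ≈ ε) → ⨁ xs f ≈ f x
  ⨁-single (y∉ ∷ u) (here refl) z = ≈-trans
    (∙-congˡ (⨁-ε _ (λ y∈ → z (there y∈) (λ eq → All.lookup y∉ y∈ (sym eq))))) (identityʳ _)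
  ⨁-single (y∉ ∷ u) (there x∈) z = ≈-trans
    (∙-cong (z (here refl) (All.lookup y∉ x∈)) (⨁-single u x∈ (z ∘ there))) (identityˡ _)

  ⨁-if : ∀ {a} {A : Set a} (xs : List A) b {f : A → Carrier} →
    ⨁ xs (λ x → if b then f x else ε) ≈ (if b then ⨁ xs f else ε)
  ⨁-if xs true  = ≈-refl
  ⨁-if xs false = ⨁-ε xs (λ _ → ≈-refl)

  ⨁-interval : ∀ W G B (f : ℕ → Carrier) → B ≤ W →
    ⨁ (upTo W) (λ i → if (G <ᵇ suc i) ∧ (suc i ≤ᵇ B) then f (suc i) else ε)
      ≈ ⨁ (upTo (B ∸ G)) (λ d → f (G + suc d))
  ⨁-interval W zero zero f le = ⨁-ε (upTo W) (λ _ → ≈-refl)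
  ⨁-interval (suc W) zero (suc B) f (s≤s le) = begin
    ⨁ (upTo (suc W)) (λ i → if suc i ≤ᵇ suc B then f (suc i) else ε)   ≡⟨ ⨁-upTo-suc W _ ⟩
    f 1 ∙ ⨁ (upTo W) (λ i → if suc i ≤ᵇ B then f (suc (suc i)) else ε) ≈⟨ ∙-congˡ (⨁-interval W 0 B (f ∘ suc) le) ⟩
    f 1 ∙ ⨁ (upTo B) (λ d → f (suc (suc d)))                           ≡⟨ ⨁-upTo-suc B _ ⟨
    ⨁ (upTo (suc B)) (λ d → f (suc d))                                 ∎
  ⨁-interval W (suc G) zero f le = ⨁-ε (upTo W) (λ {i} _ → reflexive (lem i))
    where
    lem : ∀ i → (if (suc G <ᵇ suc i) ∧ false then f (suc i) else ε) ≡ ε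
    lem i with suc G <ᵇ suc i
    ... | true  = refl
    ... | false = refl
  ⨁-interval (suc W) (suc G) (suc B) f (s≤s le) = begin
    _                               ≡⟨ ⨁-upTo-suc W _ ⟩
    ε ∙ _                           ≈⟨ identityˡ _ ⟩
    _                               ≈⟨ ⨁-interval W G B (f ∘ suc) le ⟩
    _                               ∎

open BigOp +-0-commutativeMonoid public using () renaming
  ( ⨁ to ∑; ⨁-cong to ∑-cong; ⨁-ε to ∑-zero; ⨁-∙ to ∑-+; ⨁-swap to ∑-swap; ⨁-map to ∑-map
  ; ⨁-upTo-suc to ∑-upTo-suc; ⨁-single to ∑-single; ⨁-concatMap to ∑-concatMap; ⨁-if to ∑-if)

countL≡∑ : ∀ {A : Set} (f : A → Bool) xs → countL f xs ≡ ∑ xs (b2n ∘ f)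
countL≡∑ f []       = refl
countL≡∑ f (x ∷ xs) with f x
... | true  = cong suc (countL≡∑ f xs)
... | false = countL≡∑ f xs

T⇒≡true : ∀ {b} → T b → b ≡ true
T⇒≡true {true} _ = refl

¬T⇒≡false : ∀ {b} → ¬ T b → b ≡ false
¬T⇒≡false {true}  f = ⊥-elim (f tt)
¬T⇒≡false {false} f = refl

T-∧⁺ : ∀ {a b} → T a → T b → T (a ∧ b)
T-∧⁺ {true} _ q = q

T-∧⁻ : ∀ a {b} → T (a ∧ b) → T a × T b
T-∧⁻ true q = tt , q

≤ᵇ-true : ∀ {m n} → m ≤ n → (m ≤ᵇ n) ≡ true
≤ᵇ-true = T⇒≡true ∘ ≤⇒≤ᵇ

≤ᵇ-false : ∀ {m n} → n < m → (m ≤ᵇ n) ≡ false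
≤ᵇ-false {m} {n} lt = ¬T⇒≡false (λ t → <⇒≱ lt (≤ᵇ⇒≤ m n t))

<ᵇ-true : ∀ {m n} → m < n → (m <ᵇ n) ≡ true
<ᵇ-true = T⇒≡true ∘ <⇒<ᵇ

<ᵇ-false : ∀ {m n} → n ≤ m → (m <ᵇ n) ≡ false
<ᵇ-false {m} {n} le = ¬T⇒≡false (λ t → ≤⇒≯ le (<ᵇ⇒< m n t))

cnt : (ℕ → Bool) → ℕ → ℕ
cnt P p = ∑ (map suc (upTo p)) (b2n ∘ P)

cnt-suc : ∀ P p → cnt P (suc p) ≡ b2n (P 1) + cnt (P ∘ suc) p
cnt-suc P p = trans (∑-map suc (upTo (suc p)) (b2n ∘ P))
  (trans (∑-upTo-suc p (b2n ∘ P ∘ suc)) (cong (b2n (P 1) +_) (sym (∑-map suc (upTo p) (b2n ∘ P ∘ suc)))))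

b2n≤1 : ∀ b → b2n b ≤ 1
b2n≤1 true  = ≤-refl
b2n≤1 false = z≤n

cnt≤ : ∀ P p → cnt P p ≤ p
cnt≤ P zero    = z≤n
cnt≤ P (suc p) rewrite cnt-suc P p = +-mono-≤ (b2n≤1 (P 1)) (cnt≤ (P ∘ suc) p)

DownClosed : (ℕ → Bool) → ℕ → Set
DownClosed P p = ∀ r → 1 ≤ r → suc r ≤ p → T (P (suc r)) → T (P r)

cnt-downClosed : ∀ P p → DownClosed P p → ∀ r → 1 ≤ r → r ≤ p →
  (r ≤ cnt P p → T (P r)) × (T (P r) → r ≤ cnt P p)
cnt-downClosed P zero dc (suc r) _ ()
cnt-downClosed P (suc p) dc r 1≤r r≤p with P 1 in eq | cnt-suc P p
... | true | s rewrite s = go r 1≤r r≤p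
  where
  go : ∀ r → 1 ≤ r → r ≤ suc p → (r ≤ suc (cnt (P ∘ suc) p) → T (P r)) × (T (P r) → r ≤ suc (cnt (P ∘ suc) p))
  go 1 _ _ = (λ _ → subst T (sym eq) tt) , (λ _ → s≤s z≤n)
  go (suc (suc r)) _ (s≤s le) = (λ { (s≤s q) → proj₁ ih q }) , (λ t → s≤s (proj₂ ih t))
    where ih = cnt-downClosed (P ∘ suc) p (λ r′ a b → dc (suc r′) (s≤s z≤n) (s≤s b)) (suc r) (s≤s z≤n) le
... | false | s rewrite s = (λ q → ⊥-elim (empty (≤-trans 1≤r q))) , (λ t → ⊥-elim (none r 1≤r r≤p t))
  where
  none : ∀ r → 1 ≤ r → r ≤ suc p → ¬ T (P r)
  none 1 _ _ t = subst T eq t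
  none (suc (suc r)) _ le t = none (suc r) (s≤s z≤n) (≤-trans (n≤1+n _) le) (dc (suc r) (s≤s z≤n) le t)
  empty : ¬ 1 ≤ cnt (P ∘ suc) p
  empty q = none 2 (s≤s z≤n) (s≤s 1≤p)
    (proj₁ (cnt-downClosed (P ∘ suc) p (λ r′ a b → dc (suc r′) (s≤s z≤n) (s≤s b)) 1 (s≤s z≤n) 1≤p) q)
    where 1≤p = ≤-trans q (cnt≤ (P ∘ suc) p)

≤-bySections : ∀ {m m′ n} → m ≤ n → (∀ r → 1 ≤ r → r ≤ n → r ≤ m → r ≤ m′) → m ≤ m′
≤-bySections {zero}  _  f = z≤n
≤-bySections {suc m} le f = f (suc m) (s≤s z≤n) le ≤-refl

≡-bySections : ∀ {m m′ n} → m ≤ n → m′ ≤ n →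
  (∀ r → 1 ≤ r → r ≤ n → (r ≤ m → r ≤ m′) × (r ≤ m′ → r ≤ m)) → m ≡ m′
≡-bySections le le′ f = ≤-antisym (≤-bySections le (λ r a b → proj₁ (f r a b)))
                                  (≤-bySections le′ (λ r a b → proj₂ (f r a b)))

anyL≡∑ : ∀ {A : Set} (Q : A → Bool) {xs} → Unique xs →
  (∀ {x y} → x ∈ xs → y ∈ xs → T (Q x) → T (Q y) → x ≡ y) → b2n (anyL Q xs) ≡ ∑ xs (b2n ∘ Q)
anyL≡∑ Q [] inj = refl
anyL≡∑ Q {x ∷ xs} (x∉ ∷ u) inj with Q x in eq
... | true = cong suc (sym (∑-zero xs λ {y} y∈ → cong b2n (¬T⇒≡false λ t →
        All.lookup x∉ y∈ (inj (here refl) (there y∈) (subst T (sym eq) tt) t))))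
... | false = anyL≡∑ Q u (λ p q → inj (there p) (there q))

∈-rows⁻ : ∀ {r p} → r ∈ map suc (upTo p) → 1 ≤ r × r ≤ p
∈-rows⁻ m with ∈-map⁻ suc m
... | i , i∈ , refl = s≤s z≤n , ∈-upTo⁻ i∈

∈-rows⁺ : ∀ {r p} → 1 ≤ r → r ≤ p → r ∈ map suc (upTo p)
∈-rows⁺ {suc r} _ le = ∈-map⁺ suc (∈-upTo⁺ le)

rows-unique : ∀ p → Unique (map suc (upTo p))
rows-unique p = Unique.map⁺ suc-injective (Unique.upTo⁺ p)

-- The heights around a face: x below right, a below left, d above right, y above left.
-- The four edges are the increments along the boundary of this square.
record Square (x a d y : ℕ) : Set where
  constructor square
  field
    x≤a : x ≤ a
    x≤d : x ≤ d
    a≤y : a ≤ y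
    d≤y : d ≤ y
    y≤1+x : y ≤ suc x

<ᵇ-step : ∀ {m n} → m ≤ n → n ≤ suc m → n ≡ b2n (m <ᵇ n) + m
<ᵇ-step {m} {n} le le′ with m≤n⇒m<n∨m≡n le
... | inj₁ lt rewrite <ᵇ-true lt = ≤-antisym le′ lt
... | inj₂ refl rewrite <ᵇ-false (≤-refl {m}) = refl

module _ {x a d y : ℕ} (sq : Square x a d y) where
  open Square sq

  square-left : a ≡ b2n (x <ᵇ a) + x
  square-left = <ᵇ-step x≤a (≤-trans a≤y y≤1+x)

  square-right : y ≡ b2n (d <ᵇ y) + d
  square-right = <ᵇ-step d≤y (≤-trans y≤1+x (s≤s x≤d))

  square-bottom : y ≡ b2n (a <ᵇ y) + a
  square-bottom = <ᵇ-step a≤y (≤-trans y≤1+x (s≤s x≤a))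

  square-top : d ≡ b2n (x <ᵇ d) + x
  square-top = <ᵇ-step x≤d (≤-trans d≤y y≤1+x)

  square-in : y ≡ (b2n (x <ᵇ a) + b2n (a <ᵇ y)) + x
  square-in = trans square-bottom (trans (cong (b2n (a <ᵇ y) +_) square-left)
    (trans (sym (+-assoc (b2n (a <ᵇ y)) _ x)) (cong (_+ x) (+-comm (b2n (a <ᵇ y)) _))))

  square-conserve : b2n (x <ᵇ a) + b2n (a <ᵇ y) ≡ b2n (d <ᵇ y) + b2n (x <ᵇ d)
  square-conserve = +-cancelʳ-≡ x _ _ (trans (sym square-in) (trans square-right
    (trans (cong (b2n (d <ᵇ y) +_) square-top) (sym (+-assoc (b2n (d <ᵇ y)) _ x)))))

  square-exclusive : not ((x <ᵇ a) ∧ (a <ᵇ y)) ≡ true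
  square-exclusive with x <ᵇ a in e | a <ᵇ y in e′
  ... | false | _     = refl
  ... | true  | false = refl
  ... | true  | true  = ⊥-elim (<⇒≱ (≤-<-trans (<ᵇ⇒< x a (subst T (sym e) tt)) (<ᵇ⇒< a y (subst T (sym e′) tt))) y≤1+x)

vec-ext : ∀ {A : Set} {k} {u v : Vec A k} → (∀ a → lookup u a ≡ lookup v a) → u ≡ v
vec-ext {u = []}    {[]}    eq = refl
vec-ext {u = x ∷ u} {y ∷ v} eq = cong₂ _∷_ (eq zero) (vec-ext (eq ∘ suc))

b2n-injective : ∀ {a b} → b2n a ≡ b2n b → a ≡ b
b2n-injective {true}  {true}  _ = refl
b2n-injective {false} {false} _ = refl

eqB⇒≡ : ∀ {a b} → eqB a b ≡ true → a ≡ b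
eqB⇒≡ {true}  {true}  _ = refl
eqB⇒≡ {false} {false} _ = refl

eqV⇒≡ : ∀ {k} {u v : Vec Bool k} → eqV u v ≡ true → u ≡ v
eqV⇒≡ {u = []}    {[]}    _ = refl
eqV⇒≡ {u = a ∷ u} {b ∷ v} e with eqB a b in eq
... | true = cong₂ _∷_ (eqB⇒≡ eq) (eqV⇒≡ e)

eqLV⇒≡ : ∀ {k} {us vs : List (Vec Bool k)} → eqLV us vs ≡ true → us ≡ vs
eqLV⇒≡ {us = []}     {[]}     _ = refl
eqLV⇒≡ {us = u ∷ us} {v ∷ vs} e with eqV u v in eq
... | true = cong₂ _∷_ (eqV⇒≡ eq) (eqLV⇒≡ e)

eqB-refl : ∀ a → eqB a a ≡ true
eqB-refl true  = refl
eqB-refl false = refl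

eqV-refl : ∀ {k} (u : Vec Bool k) → eqV u u ≡ true
eqV-refl []      = refl
eqV-refl (a ∷ u) rewrite eqB-refl a = eqV-refl u

eqLV-refl : ∀ {k} (us : List (Vec Bool k)) → eqLV us us ≡ true
eqLV-refl []       = refl
eqLV-refl (u ∷ us) rewrite eqV-refl u = eqLV-refl us

∈-allVecs : ∀ {k} (v : Vec Bool k) → v ∈ allVecs k
∈-allVecs []          = here refl
∈-allVecs (false ∷ v) = ∈-concatMap _ (∈-allVecs v) (here refl)
∈-allVecs (true ∷ v)  = ∈-concatMap _ (∈-allVecs v) (there (here refl))

allVecs-unique : ∀ k → Unique (allVecs k)
allVecs-unique zero    = [] ∷ []
allVecs-unique (suc k) = concatMap-unique _ Vec.tail
  (λ { (here refl) → refl ; (there (here refl)) → refl ; (there (there ())) })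
  (λ v → ((λ ()) ∷ []) ∷ [] ∷ []) (allVecs-unique k)

tailL : ∀ {A : Set} → List A → List A
tailL []       = []
tailL (x ∷ xs) = xs

sequences : ∀ {A : Set} → List A → ℕ → List (List A)
sequences xs zero    = [] ∷ []
sequences xs (suc N) = concatMap (λ s → map (λ v → v ∷ s) xs) (sequences xs N)

allSeqs≡sequences : ∀ k N → allSeqs k N ≡ sequences (allVecs k) N
allSeqs≡sequences k zero    = refl
allSeqs≡sequences k (suc N) = cong (concatMap (λ s → map (λ v → v ∷ s) (allVecs k))) (allSeqs≡sequences k N)

sequences-unique : ∀ {A : Set} {xs : List A} → Unique xs → ∀ N → Unique (sequences xs N)
sequences-unique u zero    = [] ∷ []
sequences-unique {xs = xs} u (suc N) = concatMap-unique _ tailL tail-eq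
  (λ s → Unique.map⁺ (λ { refl → refl }) u) (sequences-unique u N)
  where
  tail-eq : ∀ {s y} → y ∈ map (λ v → v ∷ s) xs → tailL y ≡ s
  tail-eq {s} m with ∈-map⁻ (λ v → v ∷ s) m
  ... | _ , _ , refl = refl

∈-sequences : ∀ {A : Set} {xs : List A} s → (∀ {v} → v ∈ s → v ∈ xs) → s ∈ sequences xs (length s)
∈-sequences []      _ = here refl
∈-sequences (v ∷ s) h = ∈-concatMap _ (∈-sequences s (h ∘ there)) (∈-map⁺ (λ v → v ∷ s) (h (here refl)))

∈-sequences⁻ : ∀ {A : Set} {xs : List A} N {s} → s ∈ sequences xs N → length s ≡ N × (∀ {v} → v ∈ s → v ∈ xs)
∈-sequences⁻ zero (here refl) = refl , λ ()
∈-sequences⁻ {xs = xs} (suc N) m with ∈-concatMap⁻ (λ s → map (λ v → v ∷ s) xs) (sequences xs N) m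
... | s , s∈ , q with ∈-map⁻ (λ v → v ∷ s) q
...   | v , v∈ , refl with ∈-sequences⁻ N s∈
...     | len , h = cong suc len , λ { (here refl) → v∈ ; (there i) → h i }

suffix : ∀ {k} → Fin k → List (Vec Bool k) → ℕ → ℕ
suffix a []       j       = 0
suffix a (v ∷ vs) zero    = b2n (lookup v a) + suffix a vs zero
suffix a (v ∷ vs) (suc j) = suffix a vs j

suffix-antitone : ∀ {k} (a : Fin k) vs j → suffix a vs (suc j) ≤ suffix a vs j
suffix-antitone a []       j       = z≤n
suffix-antitone a (v ∷ vs) zero    = m≤n+m _ (b2n (lookup v a))
suffix-antitone a (v ∷ vs) (suc j) = suffix-antitone a vs j

suffix-injective : ∀ {k} {us vs : List (Vec Bool k)} → length us ≡ length vs →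
  (∀ a j → suffix a us j ≡ suffix a vs j) → us ≡ vs
suffix-injective {us = []}     {[]}     _ _ = refl
suffix-injective {us = u ∷ us} {v ∷ vs} len eq with suffix-injective {us = us} {vs} (suc-injective len) (λ a → eq a ∘ suc)
... | refl = cong (_∷ us) (vec-ext λ a → b2n-injective (+-cancelʳ-≡ (suffix a us 0) _ _ (eq a 0)))

suffix-applyUpTo : ∀ {k} (a : Fin k) (f : ℕ → Vec Bool k) w (h : ℕ → ℕ) →
  (∀ i → h i ≡ b2n (lookup (f i) a) + h (suc i)) → (∀ j → w ≤ j → h j ≡ 0) →
  ∀ j → suffix a (applyUpTo f w) j ≡ h j
suffix-applyUpTo a f zero    h step end j       = sym (end j z≤n)
suffix-applyUpTo a f (suc w) h step end zero    = trans
  (cong (b2n (lookup (f 0) a) +_) (suffix-applyUpTo a (f ∘ suc) w (h ∘ suc) (step ∘ suc) (λ j le → end (suc j) (s≤s le)) 0))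
  (sym (step 0))
suffix-applyUpTo a f (suc w) h step end (suc j) =
  suffix-applyUpTo a (f ∘ suc) w (h ∘ suc) (step ∘ suc) (λ j le → end (suc j) (s≤s le)) j

Interlaced : ∀ {k} → List (Vec Bool k) → List (Vec Bool k) → Set
Interlaced Is Ks = ∀ a j → suffix a Is j ≤ suffix a Ks j × suffix a Ks j ≤ suc (suffix a Is (suc j))

nth : ∀ {A : Set} → List (List A) → ℕ → List A
nth []       e       = []
nth (r ∷ rs) zero    = r
nth (r ∷ rs) (suc e) = nth rs e

nth-applyUpTo : ∀ {A : Set} (f : ℕ → List A) n e → e < n → nth (applyUpTo f n) e ≡ f e
nth-applyUpTo f (suc n) zero    lt = refl
nth-applyUpTo f (suc n) (suc e) (s≤s lt) = nth-applyUpTo (f ∘ suc) n e lt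

nth-ext : ∀ {A : Set} {rs ss : List (List A)} → length rs ≡ length ss →
  (∀ e → e < length rs → nth rs e ≡ nth ss e) → rs ≡ ss
nth-ext {rs = []}     {[]}     _ _ = refl
nth-ext {rs = r ∷ rs} {s ∷ ss} len eq =
  cong₂ _∷_ (eq 0 (s≤s z≤n)) (nth-ext (suc-injective len) (λ e lt → eq (suc e) (s≤s lt)))

nth-∈ : ∀ {A : Set} (rs : List (List A)) e → e < length rs → nth rs e ∈ rs
nth-∈ (r ∷ rs) zero    lt = here refl
nth-∈ (r ∷ rs) (suc e) (s≤s lt) = there (nth-∈ rs e lt)

∑-allFin-suc : ∀ k (f : Fin (suc k) → ℕ) → ∑ (allFin (suc k)) f ≡ f zero + ∑ (allFin k) (f ∘ suc)
∑-allFin-suc k f = cong (f zero +_) (trans (cong (λ l → ∑ l f) (sym (map-tabulate id suc))) (∑-map suc (allFin k) f))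

cntV-tabulate : ∀ {k} (f : Fin k → Bool) → cntV (tabulate f) ≡ ∑ (allFin k) (b2n ∘ f)
cntV-tabulate {zero}  f = refl
cntV-tabulate {suc k} f = trans (cong (b2n (f zero) +_) (cntV-tabulate (f ∘ suc))) (sym (∑-allFin-suc k (b2n ∘ f)))

above : ∀ {k} → (Fin k → ℕ) → Fin k → ℕ
above {k} f a = ∑ (allFin k) (λ b → if toℕ a <ᵇ toℕ b then f b else 0)

above-zero : ∀ {k} (f : Fin (suc k) → ℕ) → above f zero ≡ ∑ (allFin k) (f ∘ suc)
above-zero {k} f = ∑-allFin-suc k (λ b → if 0 <ᵇ toℕ b then f b else 0)

above-suc : ∀ {k} (f : Fin (suc k) → ℕ) a → above f (suc a) ≡ above (f ∘ suc) a
above-suc {k} f a = ∑-allFin-suc k (λ b → if suc (toℕ a) <ᵇ toℕ b then f b else 0)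

module Lattice {c ℓ : Level} (R : CommutativeSemiring c ℓ) where
  open CommutativeSemiring R using (Carrier; _≈_; 0#; 1#; setoid)
    renaming ( +-commutativeMonoid to ⊕-commutativeMonoid; *-commutativeMonoid to ⊛-commutativeMonoid;  _+_ to _⊕_; _*_ to _⊛_; refl to ≈-refl; sym to ≈-sym; trans to ≈-trans; reflexive to ≈-reflexive
             ; *-cong to ⊛-cong; *-congˡ to ⊛-congˡ; *-congʳ to ⊛-congʳ; *-identityˡ to ⊛-identityˡ; *-identityʳ to ⊛-identityʳ
             ; *-assoc to ⊛-assoc; zeroˡ to ⊛-zeroˡ; zeroʳ to ⊛-zeroʳ; distribˡ to ⊛-distribˡ)
  open Weights R
  open import Relation.Binary.Reasoning.Setoid setoid
  open import Algebra.Properties.CommutativeSemigroup (CommutativeMonoid.commutativeSemigroup ⊛-commutativeMonoid) using (interchange)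
  open BigOp ⊕-commutativeMonoid public using () renaming
    ( ⨁ to Σ′; ⨁-cong to Σ-cong; ⨁-ε to Σ-zero; ⨁-swap to Σ-swap; ⨁-map to Σ-map
    ; ⨁-single to Σ-single; ⨁-concatMap to Σ-concatMap)
  open BigOp ⊛-commutativeMonoid public using () renaming
    ( ⨁ to Π′; ⨁-cong to Π-cong; ⨁-ε to Π-one; ⨁-∙ to Π-⊛; ⨁-swap to Π-swap; ⨁-map to Π-map
    ; ⨁-upTo-suc to Π-upTo-suc; ⨁-single to Π-single; ⨁-interval to Π-interval)

  Σ-⊛ : ∀ {a} {A : Set a} y (xs : List A) (f : A → Carrier) → y ⊛ Σ′ xs f ≈ Σ′ xs (λ x → y ⊛ f x)
  Σ-⊛ y []       f = ⊛-zeroʳ y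
  Σ-⊛ y (x ∷ xs) f = ≈-trans (⊛-distribˡ y (f x) _) (CommutativeSemiring.+-congˡ R (Σ-⊛ y xs f))

  pow-+ : ∀ x m n → pow x (m + n) ≈ pow x m ⊛ pow x n
  pow-+ x zero    n = ≈-sym (⊛-identityˡ _)
  pow-+ x (suc m) n = ≈-trans (⊛-congˡ (pow-+ x m n)) (≈-sym (⊛-assoc _ _ _))

  pow-∑ : ∀ {a} {A : Set a} x (xs : List A) (f : A → ℕ) → pow x (∑ xs f) ≈ Π′ xs (λ y → pow x (f y))
  pow-∑ x []       f = ≈-refl
  pow-∑ x (y ∷ ys) f = ≈-trans (pow-+ x (f y) _) (⊛-congˡ (pow-∑ x ys f))

  pow-b2n : ∀ x b → pow x (b2n b) ≈ (if b then x else 1#)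
  pow-b2n x true  = ⊛-identityʳ x
  pow-b2n x false = ≈-refl

  colorWeight : ∀ {k} → Carrier → Carrier → (I J : Fin k → Bool) → Fin k → Carrier
  colorWeight x t I J a = x ⊛ pow t (above (λ b → b2n (I b) + b2n (J b)) a)

  Π-allFin-suc : ∀ k (f : Fin (suc k) → Carrier) → Π′ (allFin (suc k)) f ≡ f zero ⊛ Π′ (allFin k) (f ∘ suc)
  Π-allFin-suc k f = cong (f zero ⊛_) (trans (cong (λ l → Π′ l f) (sym (map-tabulate id suc))) (Π-map suc (allFin k) f))

  faceMonomial : ∀ {k} → Carrier → Carrier → (I J L : Vec Bool k) → Carrier
  faceMonomial x t I J L = pow x (cntV L) ⊛ pow t (texp I J L)

  faceMonomial-colors : ∀ {k} x t (I J L : Fin k → Bool) →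
    faceMonomial x t (tabulate I) (tabulate J) (tabulate L)
      ≈ Π′ (allFin k) (λ a → if L a then colorWeight x t I J a else 1#)
  faceMonomial-colors {zero}  x t I J L = ⊛-identityˡ 1#
  faceMonomial-colors {suc k} x t I J L = begin
    pow x (b2n (L zero) + cntV (tabulate L′)) ⊛ pow t (E + texp (tabulate I′) (tabulate J′) (tabulate L′))
      ≈⟨ ⊛-cong (pow-+ x (b2n (L zero)) _) (pow-+ t E _) ⟩
    (pow x (b2n (L zero)) ⊛ pow x (cntV (tabulate L′))) ⊛ (pow t E ⊛ pow t (texp (tabulate I′) (tabulate J′) (tabulate L′)))
      ≈⟨ interchange _ _ _ _ ⟩
    (pow x (b2n (L zero)) ⊛ pow t E) ⊛ faceMonomial x t (tabulate I′) (tabulate J′) (tabulate L′)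
      ≈⟨ ⊛-cong (first (L zero)) (faceMonomial-colors x t I′ J′ L′) ⟩
    F zero ⊛ Π′ (allFin k) (λ a → if L′ a then colorWeight x t I′ J′ a else 1#)
      ≈⟨ ⊛-congˡ (Π-cong (allFin k) (λ {a} _ → ≈-reflexive (cong (λ m → if L′ a then x ⊛ pow t m else 1#) (sym (above-suc _ a))))) ⟩
    F zero ⊛ Π′ (allFin k) (F ∘ suc)
      ≡⟨ Π-allFin-suc k F ⟨
    Π′ (allFin (suc k)) F ∎
    where
    I′ = I ∘ suc
    J′ = J ∘ suc
    L′ = L ∘ suc
    F : Fin (suc k) → Carrier
    F a = if L a then colorWeight x t I J a else 1#
    E = if L zero then cntV (tabulate I′) + cntV (tabulate J′) else 0
    total : cntV (tabulate I′) + cntV (tabulate J′) ≡ above (λ b → b2n (I b) + b2n (J b)) zero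
    total = trans (cong₂ _+_ (cntV-tabulate I′) (cntV-tabulate J′))
      (trans (sym (∑-+ (allFin k) (b2n ∘ I′) (b2n ∘ J′))) (sym (above-zero (λ b → b2n (I b) + b2n (J b)))))
    first : ∀ l → pow x (b2n l) ⊛ pow t (if l then cntV (tabulate I′) + cntV (tabulate J′) else 0)
                    ≈ (if l then colorWeight x t I J zero else 1#)
    first true  = ⊛-cong (⊛-identityʳ x) (≈-reflexive (cong (pow t) total))
    first false = ⊛-identityˡ 1#

  outgoing : ∀ {k} → Vec Bool k → Vec Bool k → Vec Bool k → Vec Bool k
  outgoing []      []      []      = []
  outgoing (i ∷ I) (j ∷ J) (k ∷ K) = ((i ∨ j) ∧ not k) ∷ outgoing I J K

  okFace-∷ : ∀ {m} i j k l (I J K L : Vec Bool m) → okFace (i ∷ I) (j ∷ J) (k ∷ K) (l ∷ L) ≡ true →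
    (b2n i + b2n j ≡ b2n k + b2n l) × (b2n i + b2n j ≤ 1) × (l ≡ (i ∨ j) ∧ not k) × okFace I J K L ≡ true
  okFace-∷ false false false false _ _ _ _ e = refl , z≤n , refl , e
  okFace-∷ false true  false true  _ _ _ _ e = refl , s≤s z≤n , refl , e
  okFace-∷ false true  true  false _ _ _ _ e = refl , s≤s z≤n , refl , e
  okFace-∷ true  true  true  true  _ _ _ _ ()
  okFace-∷ true  true  true  false _ _ _ _ ()
  okFace-∷ true  true  false true  _ _ _ _ ()
  okFace-∷ true  true  false false _ _ _ _ ()
  okFace-∷ true  false false true  _ _ _ _ e = refl , s≤s z≤n , refl , e
  okFace-∷ true  false true  false _ _ _ _ e = refl , s≤s z≤n , refl , e

  okFace-outgoing : ∀ {m} (I J K L : Vec Bool m) → okFace I J K L ≡ true → L ≡ outgoing I J K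
  okFace-outgoing []      []      []      []      _ = refl
  okFace-outgoing (i ∷ I) (j ∷ J) (k ∷ K) (l ∷ L) e with okFace-∷ i j k l I J K L e
  ... | _ , _ , eq , rest = cong₂ _∷_ eq (okFace-outgoing I J K L rest)

  okFace-lookup : ∀ {m} (I J K L : Vec Bool m) → okFace I J K L ≡ true → ∀ a →
    (b2n (lookup I a) + b2n (lookup J a) ≡ b2n (lookup K a) + b2n (lookup L a)) × (b2n (lookup I a) + b2n (lookup J a) ≤ 1)
  okFace-lookup (i ∷ I) (j ∷ J) (k ∷ K) (l ∷ L) e a with okFace-∷ i j k l I J K L e
  okFace-lookup (i ∷ I) (j ∷ J) (k ∷ K) (l ∷ L) e zero    | p , q , _ , _ = p , q
  okFace-lookup (i ∷ I) (j ∷ J) (k ∷ K) (l ∷ L) e (suc a) | _ , _ , _ , r = okFace-lookup I J K L r a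

  okFace-tabulate : ∀ {m} (I J K L : Fin m → Bool) →
    (∀ a → b2n (I a) + b2n (J a) ≡ b2n (K a) + b2n (L a)) → (∀ a → not (I a ∧ J a) ≡ true) →
    okFace (tabulate I) (tabulate J) (tabulate K) (tabulate L) ≡ true
  okFace-tabulate {zero}  I J K L con exc = refl
  okFace-tabulate {suc m} I J K L con exc
    rewrite con zero | T⇒≡true (≡⇒≡ᵇ (b2n (K zero) + b2n (L zero)) _ refl) | exc zero =
    okFace-tabulate (I ∘ suc) (J ∘ suc) (K ∘ suc) (L ∘ suc) (con ∘ suc) (exc ∘ suc)

  faceWeight-¬ok : ∀ {m} x t (I J K L : Vec Bool m) → okFace I J K L ≡ false → ∀ y → faceWeight x t I J K L ⊛ y ≈ 0#
  faceWeight-¬ok x t I J K L e y rewrite e = ⊛-zeroˡ y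

  rowWeight-∷ : ∀ {k} x t (J I K L : Vec Bool k) Is Ks → okFace I J K L ≡ true →
    rowWeight x t J (I ∷ Is) (K ∷ Ks) ≈ faceMonomial x t I J L ⊛ rowWeight x t L Is Ks
  rowWeight-∷ {k} x t J I K L Is Ks ok = ≈-trans
    (Σ-single (allVecs-unique k) (∈-allVecs L) others)
    (⊛-congʳ (≈-reflexive (cong (λ b → if b then faceMonomial x t I J L else 0#) ok)))
    where
    others : ∀ {L′} → L′ ∈ allVecs k → L′ ≢ L → faceWeight x t I J K L′ ⊛ rowWeight x t L′ Is Ks ≈ 0#
    others {L′} _ L′≢L with okFace I J K L′ in eq
    ... | true  = ⊥-elim (L′≢L (trans (okFace-outgoing I J K L′ eq) (sym (okFace-outgoing I J K L ok))))
    ... | false = ⊛-zeroˡ _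

  rowWeight-applyUpTo : ∀ {k} x t (I J K : ℕ → Vec Bool k) w →
    (∀ i → okFace (I i) (J i) (K i) (J (suc i)) ≡ true) → J w ≡ zeroV k →
    rowWeight x t (J 0) (applyUpTo I w) (applyUpTo K w) ≈ Π′ (upTo w) (λ i → faceMonomial x t (I i) (J i) (J (suc i)))
  rowWeight-applyUpTo {k} x t I J K zero ok end
    rewrite end | eqV-refl (zeroV k) = ≈-refl
  rowWeight-applyUpTo x t I J K (suc w) ok end = begin
    _ ≈⟨ rowWeight-∷ x t (J 0) (I 0) (K 0) (J 1) (applyUpTo (I ∘ suc) w) (applyUpTo (K ∘ suc) w) (ok 0) ⟩
    _ ≈⟨ ⊛-congˡ (rowWeight-applyUpTo x t (I ∘ suc) (J ∘ suc) (K ∘ suc) w (ok ∘ suc) end) ⟩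
    _ ≡⟨ Π-upTo-suc w _ ⟨
    _ ∎

  rowWeight-support : ∀ {k} x t (J : Vec Bool k) Is Ks →
    rowWeight x t J Is Ks ≈ 0# ⊎
    (Interlaced Is Ks × (∀ a → suffix a Ks 0 ≡ b2n (lookup J a) + suffix a Is 0))
  rowWeight-support {k} x t J [] [] with eqV J (zeroV k) in eq
  ... | false = inj₁ ≈-refl
  ... | true with eqV⇒≡ {u = J} eq
  ...   | refl = inj₂ ((λ a j → z≤n , z≤n) , λ a → cong (λ b → b2n b + 0) (sym (lookup-replicate a false)))
  rowWeight-support x t J [] (K ∷ Ks) = inj₁ ≈-refl
  rowWeight-support x t J (I ∷ Is) [] = inj₁ ≈-refl
  rowWeight-support {k} x t J (I ∷ Is) (K ∷ Ks) with okFace I J K (outgoing I J K) in eq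
  ... | false = inj₁ (Σ-zero (allVecs k) λ {L} _ → faceWeight-¬ok x t I J K L (¬ok L) _)
    where
    ¬ok : ∀ L → okFace I J K L ≡ false
    ¬ok L with okFace I J K L in e
    ... | false = refl
    ... | true = trans (sym e) (trans (cong (okFace I J K) (okFace-outgoing I J K L e)) eq)
  ... | true with rowWeight-support x t (outgoing I J K) Is Ks
  ...   | inj₁ z = inj₁ (≈-trans (rowWeight-∷ x t J I K _ Is Ks eq) (≈-trans (⊛-congˡ z) (⊛-zeroʳ _)))
  ...   | inj₂ (il , flux) = inj₂ (il′ , flux′)
    where
    L = outgoing I J K
    in-flux : ∀ a → suffix a (K ∷ Ks) 0 ≡ (b2n (lookup I a) + b2n (lookup J a)) + suffix a Is 0
    in-flux a with okFace-lookup I J K L eq a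
    ... | con , _ = trans (cong (b2n (lookup K a) +_) (flux a))
      (trans (sym (+-assoc (b2n (lookup K a)) _ _)) (cong (_+ suffix a Is 0) (sym con)))
    flux′ : ∀ a → suffix a (K ∷ Ks) 0 ≡ b2n (lookup J a) + suffix a (I ∷ Is) 0
    flux′ a = trans (in-flux a) (trans (cong (_+ suffix a Is 0) (+-comm (b2n (lookup I a)) _)) (+-assoc (b2n (lookup J a)) _ _))
    il′ : Interlaced (I ∷ Is) (K ∷ Ks)
    il′ a zero    = subst (suffix a (I ∷ Is) 0 ≤_) (sym (flux′ a)) (m≤n+m _ (b2n (lookup J a)))
                  , subst (_≤ suc (suffix a Is 0)) (sym (in-flux a)) (+-monoˡ-≤ _ (proj₂ (okFace-lookup I J K L eq a)))
    il′ a (suc j) = il a j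

  chainWeight : ∀ {k} → Carrier → List Carrier → (bot top : List (Vec Bool k)) → List (List (Vec Bool k)) → Carrier
  chainWeight t []       bot top _        = if eqLV bot top then 1# else 0#
  chainWeight t (x ∷ xs) bot top []       = 0#
  chainWeight {k} t (x ∷ xs) bot top (m ∷ ms) = rowWeight x t (zeroV k) bot m ⊛ chainWeight t xs m top ms

  chains : ∀ k → ℕ → ℕ → List (List (List (Vec Bool k)))
  chains k W n = sequences (allSeqs k W) n

  latticeZ-chains : ∀ {k} t xs (bot top : List (Vec Bool k)) →
    latticeZ t xs bot top ≈ Σ′ (chains k (length bot) (length xs)) (chainWeight t xs bot top)
  latticeZ-chains t []       bot top = ≈-sym (CommutativeSemiring.+-identityʳ R _)
  latticeZ-chains {k} t (x ∷ xs) bot top = begin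
    Σ′ S (λ m → row m ⊛ latticeZ t xs m top)
      ≈⟨ Σ-cong S (λ {m} m∈ → ⊛-congˡ (≈-trans (latticeZ-chains t xs m top)
           (≈-reflexive (cong (λ w → Σ′ (chains k w (length xs)) (chainWeight t xs m top)) (len m∈))))) ⟩
    Σ′ S (λ m → row m ⊛ Σ′ C (chainWeight t xs m top))
      ≈⟨ Σ-cong S (λ {m} _ → Σ-⊛ (row m) C _) ⟩
    Σ′ S (λ m → Σ′ C (λ ms → row m ⊛ chainWeight t xs m top ms))
      ≈⟨ Σ-swap S C _ ⟩
    Σ′ C (λ ms → Σ′ S (λ m → row m ⊛ chainWeight t xs m top ms))
      ≈⟨ Σ-cong C (λ {ms} _ → ≈-reflexive (Σ-map (λ m → m ∷ ms) S (chainWeight t (x ∷ xs) bot top))) ⟨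
    Σ′ C (λ ms → Σ′ (map (λ m → m ∷ ms) S) (chainWeight t (x ∷ xs) bot top))
      ≈⟨ Σ-concatMap (λ ms → map (λ m → m ∷ ms) S) C _ ⟨
    Σ′ (chains k (length bot) (suc (length xs))) (chainWeight t (x ∷ xs) bot top) ∎
    where
    S = allSeqs k (length bot)
    C = chains k (length bot) (length xs)
    row = λ m → rowWeight x t (zeroV k) bot m
    len : ∀ {m} → m ∈ S → length m ≡ length bot
    len {m} m∈ = proj₁ (∈-sequences⁻ (length bot) (subst (m ∈_) (allSeqs≡sequences k (length bot)) m∈))

  chains-unique : ∀ k W n → Unique (chains k W n)
  chains-unique k W n = sequences-unique
    (subst Unique (sym (allSeqs≡sequences k W)) (sequences-unique (allVecs-unique k) W)) n

  ∈-chains : ∀ {k} W (ms : List (List (Vec Bool k))) → (∀ {m} → m ∈ ms → length m ≡ W) → ms ∈ chains k W (length ms)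
  ∈-chains {k} W ms len = ∈-sequences ms λ {m} m∈ → subst (m ∈_) (sym (allSeqs≡sequences k W))
    (subst (λ w → m ∈ sequences (allVecs k) w) (len m∈) (∈-sequences m (λ _ → ∈-allVecs _)))

  ∈-chains⁻ : ∀ {k} W n {ms : List (List (Vec Bool k))} → ms ∈ chains k W n → length ms ≡ n × (∀ {m} → m ∈ ms → length m ≡ W)
  ∈-chains⁻ {k} W n ms∈ with ∈-sequences⁻ n ms∈
  ... | len , h = len , λ {m} m∈ → proj₁ (∈-sequences⁻ W (subst (m ∈_) (allSeqs≡sequences k W) (h m∈)))

  chainWeight-support : ∀ {k} t xs (bot top : List (Vec Bool k)) ms → length ms ≡ length xs →
    chainWeight t xs bot top ms ≈ 0# ⊎
    ((∀ e → e < length ms → Interlaced (nth (bot ∷ ms) e) (nth (bot ∷ ms) (suc e))) × nth (bot ∷ ms) (length ms) ≡ top)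
  chainWeight-support t [] bot top [] _ with eqLV bot top in eq
  ... | true  = inj₂ ((λ _ ()) , eqLV⇒≡ eq)
  ... | false = inj₁ ≈-refl
  chainWeight-support {k} t (x ∷ xs) bot top (m ∷ ms) len
    with rowWeight-support x t (zeroV k) bot m | chainWeight-support t xs m top ms (suc-injective len)
  ... | inj₁ z | _ = inj₁ (≈-trans (⊛-congʳ z) (⊛-zeroˡ _))
  ... | inj₂ _ | inj₁ z = inj₁ (≈-trans (⊛-congˡ z) (⊛-zeroʳ _))
  ... | inj₂ (il , _) | inj₂ (ils , end) = inj₂ ((λ { zero _ → il ; (suc e) (s≤s lt) → ils e lt }) , end)

  chainWeight-applyUpTo : ∀ {k} t (X : ℕ → Carrier) (row : ℕ → List (Vec Bool k)) n →
    chainWeight t (applyUpTo X n) (row 0) (row n) (applyUpTo (row ∘ suc) n)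
      ≈ Π′ (upTo n) (λ e → rowWeight (X e) t (zeroV k) (row e) (row (suc e)))
  chainWeight-applyUpTo t X row zero rewrite eqLV-refl (row 0) = ≈-refl
  chainWeight-applyUpTo t X row (suc n) = ≈-trans
    (⊛-congˡ (chainWeight-applyUpTo t (X ∘ suc) (row ∘ suc) n)) (≈-reflexive (sym (Π-upTo-suc n _)))

cnt-mono : ∀ P P′ p → (∀ r → 1 ≤ r → r ≤ p → T (P r) → T (P′ r)) → cnt P p ≤ cnt P′ p
cnt-mono P P′ zero    f = z≤n
cnt-mono P P′ (suc p) f rewrite cnt-suc P p | cnt-suc P′ p =
  +-mono-≤ (b2n-mono (P 1) (P′ 1) (f 1 (s≤s z≤n) (s≤s z≤n)))
           (cnt-mono (P ∘ suc) (P′ ∘ suc) p (λ r a b → f (suc r) (s≤s z≤n) (s≤s b)))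
  where
  b2n-mono : ∀ a b → (T a → T b) → b2n a ≤ b2n b
  b2n-mono false b     g = z≤n
  b2n-mono true  true  g = ≤-refl
  b2n-mono true  false g = ⊥-elim (g tt)

cnt-all : ∀ P p → (∀ r → 1 ≤ r → r ≤ p → T (P r)) → cnt P p ≡ p
cnt-all P zero    f = refl
cnt-all P (suc p) f rewrite cnt-suc P p | T⇒≡true (f 1 (s≤s z≤n) (s≤s z≤n)) =
  cong suc (cnt-all (P ∘ suc) p (λ r a b → f (suc r) (s≤s z≤n) (s≤s b)))

cnt-cong : ∀ P P′ p → (∀ r → 1 ≤ r → r ≤ p → P r ≡ P′ r) → cnt P p ≡ cnt P′ p
cnt-cong P P′ p f = ∑-cong (map suc (upTo p)) λ r∈ → cong b2n (f _ (proj₁ (∈-rows⁻ r∈)) (proj₂ (∈-rows⁻ r∈)))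

cnt-none : ∀ P p → (∀ r → 1 ≤ r → r ≤ p → P r ≡ false) → cnt P p ≡ 0
cnt-none P p f = ∑-zero (map suc (upTo p)) λ r∈ → cong b2n (f _ (proj₁ (∈-rows⁻ r∈)) (proj₂ (∈-rows⁻ r∈)))

allL⁻ : ∀ {A : Set} {f : A → Bool} {xs x} → T (allL f xs) → x ∈ xs → T (f x)
allL⁻ {f = f} {x ∷ xs} t (here refl) = proj₁ (T-∧⁻ (f x) t)
allL⁻ {f = f} {x ∷ xs} t (there x∈)  = allL⁻ {f = f} {xs} (proj₂ (T-∧⁻ (f x) t)) x∈

allL⁺ : ∀ {A : Set} {f : A → Bool} xs → (∀ {x} → x ∈ xs → T (f x)) → T (allL f xs)
allL⁺ []       h = tt
allL⁺ (x ∷ xs) h = T-∧⁺ (h (here refl)) (allL⁺ xs (h ∘ there))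

-- Columns are renumbered so that the least particle of γ and the greatest one of β lie in
-- {0,…,W−1}: G a r and B a r are the columns of the r-th particles of γ⁽ᵃ⁾ and β⁽ᵃ⁾, and a
-- cell (r , c) belongs to the column j with j + r + P = c + Q, so G a r < j ≤ B a r.
record Coordinates {k : ℕ} (β γ : Fin k → List ℕ) : Set where
  field
    G B : Fin k → ℕ → ℕ
    P Q W : ℕ
    G-shift : ∀ a r → 1 ≤ r → r ≤ length (β a) → G a r + (r + P) ≡ part (γ a) r + Q
    B-shift : ∀ a r → 1 ≤ r → r ≤ length (β a) → B a r + (r + P) ≡ part (β a) r + Q
    γ≤β : ∀ a r → 1 ≤ r → r ≤ length (β a) → part (γ a) r ≤ part (β a) r
    γ-antitone : ∀ a r → 1 ≤ r → suc r ≤ length (β a) → part (γ a) (suc r) ≤ part (γ a) r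
    β-antitone : ∀ a r → 1 ≤ r → suc r ≤ length (β a) → part (β a) (suc r) ≤ part (β a) r
    B<W : ∀ a r → 1 ≤ r → r ≤ length (β a) → B a r < W

module Tableau {k : ℕ} {β γ : Fin k → List ℕ} (C : Coordinates β γ) (n : ℕ) where
  open Coordinates C
  open Shape β γ

  size : Fin k → ℕ → ℕ
  size a r = part (β a) r ∸ part (γ a) r

  shift-< : ∀ {g g′ c c′ s} → g + s ≡ c + Q → g′ + suc s ≡ c′ + Q → c′ ≤ c → g′ < g
  shift-< {g} {g′} {c} {c′} {s} e e′ le = +-cancelʳ-≤ s (suc g′) g
    (subst₂ _≤_ (trans (sym e′) (+-suc g′ s)) (sym e) (+-monoˡ-≤ Q le))

  G-decreasing : ∀ a r → 1 ≤ r → suc r ≤ p a → G a (suc r) < G a r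
  G-decreasing a r 1≤r r<p = shift-< (G-shift a r 1≤r (<⇒≤ r<p)) (G-shift a (suc r) (s≤s z≤n) r<p) (γ-antitone a r 1≤r r<p)

  B-decreasing : ∀ a r → 1 ≤ r → suc r ≤ p a → B a (suc r) < B a r
  B-decreasing a r 1≤r r<p = shift-< (B-shift a r 1≤r (<⇒≤ r<p)) (B-shift a (suc r) (s≤s z≤n) r<p) (β-antitone a r 1≤r r<p)

  B≡G+size : ∀ a r → 1 ≤ r → r ≤ p a → B a r ≡ G a r + size a r
  B≡G+size a r 1≤r r≤p = +-cancelʳ-≡ (r + P) (B a r) (G a r + size a r) (begin
    B a r + (r + P)                             ≡⟨ B-shift a r 1≤r r≤p ⟩
    part (β a) r + Q                            ≡⟨ cong (_+ Q) (m+[n∸m]≡n (γ≤β a r 1≤r r≤p)) ⟨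
    part (γ a) r + size a r + Q                 ≡⟨ +-assoc (part (γ a) r) _ Q ⟩
    part (γ a) r + (size a r + Q)               ≡⟨ cong (part (γ a) r +_) (+-comm (size a r) Q) ⟩
    part (γ a) r + (Q + size a r)               ≡⟨ +-assoc (part (γ a) r) Q _ ⟨
    part (γ a) r + Q + size a r                 ≡⟨ cong (_+ size a r) (G-shift a r 1≤r r≤p) ⟨
    G a r + (r + P) + size a r                  ≡⟨ +-assoc (G a r) _ _ ⟩
    G a r + ((r + P) + size a r)                ≡⟨ cong (G a r +_) (+-comm (r + P) _) ⟩
    G a r + (size a r + (r + P))                ≡⟨ +-assoc (G a r) _ _ ⟨
    G a r + size a r + (r + P)                  ∎)
    where open ≡-Reasoning

  B∸G≡size : ∀ a r → 1 ≤ r → r ≤ p a → B a r ∸ G a r ≡ size a r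
  B∸G≡size a r 1≤r r≤p = trans (cong (_∸ G a r) (B≡G+size a r 1≤r r≤p)) (m+n∸m≡n (G a r) (size a r))

  data Locate (a : Fin k) (r : ℕ) : ℕ → Set where
    low  : ∀ {j} → j ≤ G a r → Locate a r j
    cell : ∀ {j} d → j ≡ G a r + suc d → d < size a r → Locate a r j
    high : ∀ {j} → B a r < j → Locate a r j

  locate : ∀ a r → 1 ≤ r → r ≤ p a → ∀ j → Locate a r j
  locate a r 1≤r r≤p j with j ≤? G a r | j ≤? B a r
  ... | yes le | _      = low le
  ... | no gt  | no gt′ = high (≰⇒> gt′)
  ... | no gt  | yes le = cell d (sym eq) d<size
    where
    d = j ∸ suc (G a r)
    eq : G a r + suc d ≡ j
    eq = trans (+-suc (G a r) d) (m+[n∸m]≡n (≰⇒> gt))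
    d<size : d < size a r
    d<size = +-cancelˡ-≤ (G a r) (suc d) (size a r) (subst₂ _≤_ (sym eq) (B≡G+size a r 1≤r r≤p) le)

  -- Outside the shape, 0 and n + 1 play the roles of the entries 0 and ∞ in the definition of triples.
  τ : Filling → Fin k → ℕ → ℕ → ℕ
  τ F a r j = if j ≤ᵇ G a r then 0 else if j ≤ᵇ B a r then F a r (part (γ a) r + (j ∸ G a r)) else suc n

  τ-low : ∀ F {a r j} → j ≤ G a r → τ F a r j ≡ 0
  τ-low F le rewrite ≤ᵇ-true le = refl

  G+<-low : ∀ a r d → G a r < G a r + suc d
  G+<-low a r d = subst (G a r <_) (sym (+-suc (G a r) d)) (s≤s (m≤m+n (G a r) d))

  τ-cell : ∀ F {a r d} → 1 ≤ r → r ≤ p a → d < size a r → τ F a r (G a r + suc d) ≡ F a r (suc (part (γ a) r + d))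
  τ-cell F {a} {r} {d} 1≤r r≤p d<
    rewrite ≤ᵇ-false (G+<-low a r d)
          | ≤ᵇ-true (subst (G a r + suc d ≤_) (sym (B≡G+size a r 1≤r r≤p)) (+-monoʳ-≤ (G a r) d<))
          | m+n∸m≡n (G a r) (suc d) = cong (F a r) (+-suc (part (γ a) r) d)

  G≤B : ∀ a r → 1 ≤ r → r ≤ p a → G a r ≤ B a r
  G≤B a r 1≤r r≤p = subst (G a r ≤_) (sym (B≡G+size a r 1≤r r≤p)) (m≤m+n (G a r) _)

  τ-high : ∀ F {a r j} → 1 ≤ r → r ≤ p a → B a r < j → τ F a r j ≡ suc n
  τ-high F {a} {r} 1≤r r≤p lt
    rewrite ≤ᵇ-false (≤-<-trans (G≤B a r 1≤r r≤p) lt) | ≤ᵇ-false lt = refl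

  record Semistandard (F : Filling) : Set where
    field
      ≥1 : ∀ a r d → 1 ≤ r → r ≤ p a → d < size a r → 1 ≤ F a r (suc (part (γ a) r + d))
      ≤n : ∀ a r d → 1 ≤ r → r ≤ p a → d < size a r → F a r (suc (part (γ a) r + d)) ≤ n
      weak : ∀ a r j → 1 ≤ r → r ≤ p a → τ F a r j ≤ τ F a r (suc j)
      strict : ∀ a r j e → 1 ≤ r → suc r ≤ p a → suc e ≤ n → τ F a (suc r) j ≤ suc e → τ F a r (suc j) ≤ e

  -- The number of particles of colour a in the columns ≥ j after e rows of the lattice.
  height : Filling → Fin k → ℕ → ℕ → ℕ
  height F a e j = cnt (λ r → τ F a r j ≤ᵇ e) (p a)

  heightγ heightβ : Fin k → ℕ → ℕ
  heightγ a j = cnt (λ r → j ≤ᵇ G a r) (p a)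
  heightβ a j = cnt (λ r → j ≤ᵇ B a r) (p a)

  heightγ-section : ∀ a r j → 1 ≤ r → r ≤ p a → (r ≤ heightγ a j → j ≤ G a r) × (j ≤ G a r → r ≤ heightγ a j)
  heightγ-section a r j 1≤r r≤p with cnt-downClosed (λ r → j ≤ᵇ G a r) (p a) down r 1≤r r≤p
    where
    down : DownClosed (λ r → j ≤ᵇ G a r) (p a)
    down r 1≤r r<p t = ≤⇒≤ᵇ (≤-trans (≤ᵇ⇒≤ j _ t) (<⇒≤ (G-decreasing a r 1≤r r<p)))
  ... | f , g = (λ q → ≤ᵇ⇒≤ j _ (f q)) , (λ q → g (≤⇒≤ᵇ q))

  heightβ-section : ∀ a r j → 1 ≤ r → r ≤ p a → (r ≤ heightβ a j → j ≤ B a r) × (j ≤ B a r → r ≤ heightβ a j)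
  heightβ-section a r j 1≤r r≤p with cnt-downClosed (λ r → j ≤ᵇ B a r) (p a) down r 1≤r r≤p
    where
    down : DownClosed (λ r → j ≤ᵇ B a r) (p a)
    down r 1≤r r<p t = ≤⇒≤ᵇ (≤-trans (≤ᵇ⇒≤ j _ t) (<⇒≤ (B-decreasing a r 1≤r r<p)))
  ... | f , g = (λ q → ≤ᵇ⇒≤ j _ (f q)) , (λ q → g (≤⇒≤ᵇ q))

  record Heights (H : Fin k → ℕ → ℕ → ℕ) : Set where
    field
      initial : ∀ a j → H a 0 j ≡ heightγ a j
      final : ∀ a j → H a n j ≡ heightβ a j
      antitone : ∀ a e j → H a e (suc j) ≤ H a e j
      grow : ∀ a e j → e < n → H a e j ≤ H a (suc e) j
      growth≤1 : ∀ a e j → e < n → H a (suc e) j ≤ suc (H a e (suc j))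

  heights-mono : ∀ {H} → Heights H → ∀ a {e e′} j → e ≤ e′ → e′ ≤ n → H a e j ≤ H a e′ j
  heights-mono {H} hs a j le le′ = go (≤⇒≤′ le) le′
    where
    go : ∀ {e e′} → e ≤′ e′ → e′ ≤ n → H a e j ≤ H a e′ j
    go ≤′-refl      _   = ≤-refl
    go (≤′-step le) e<n = ≤-trans (go le (<⇒≤ e<n)) (Heights.grow hs a _ j e<n)

  module FromFilling {F : Filling} (ss : Semistandard F) (1≤n : 1 ≤ n) where
    open Semistandard ss

    section : ∀ a r j e → 1 ≤ r → r ≤ p a → e ≤ n →
      (r ≤ height F a e j → τ F a r j ≤ e) × (τ F a r j ≤ e → r ≤ height F a e j)
    section a r j e 1≤r r≤p e≤n with cnt-downClosed (λ r → τ F a r j ≤ᵇ e) (p a) (down e e≤n) r 1≤r r≤p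
      where
      down : ∀ e → e ≤ n → DownClosed (λ r → τ F a r j ≤ᵇ e) (p a)
      down zero    _   r 1≤r r<p t = ≤⇒≤ᵇ (≤-trans (weak a r j 1≤r (<⇒≤ r<p))
        (strict a r j 0 1≤r r<p 1≤n (m≤n⇒m≤1+n (≤ᵇ⇒≤ _ 0 t))))
      down (suc e) e<n r 1≤r r<p t = ≤⇒≤ᵇ (≤-trans (weak a r j 1≤r (<⇒≤ r<p))
        (m≤n⇒m≤1+n (strict a r j e 1≤r r<p e<n (≤ᵇ⇒≤ _ (suc e) t))))
    ... | f , g = (λ q → ≤ᵇ⇒≤ _ e (f q)) , (λ q → g (≤⇒≤ᵇ q))

    heights : Heights (height F)
    heights = record
      { initial = λ a j → cnt-cong _ _ (p a) (λ r 1≤r r≤p → initial′ a r j 1≤r r≤p)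
      ; final = λ a j → cnt-cong _ _ (p a) (λ r 1≤r r≤p → final′ a r j 1≤r r≤p)
      ; antitone = λ a e j → cnt-mono _ _ (p a) (λ r 1≤r r≤p t → ≤⇒≤ᵇ (≤-trans (weak a r j 1≤r r≤p) (≤ᵇ⇒≤ _ e t)))
      ; grow = λ a e j _ → cnt-mono _ _ (p a) (λ r _ _ t → ≤⇒≤ᵇ (m≤n⇒m≤1+n (≤ᵇ⇒≤ (τ F a r j) e t)))
      ; growth≤1 = growth≤1′
      }
      where
      initial′ : ∀ a r j → 1 ≤ r → r ≤ p a → (τ F a r j ≤ᵇ 0) ≡ (j ≤ᵇ G a r)
      initial′ a r j 1≤r r≤p with locate a r 1≤r r≤p j
      ... | low le  rewrite τ-low F le | ≤ᵇ-true le = refl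
      ... | cell d refl d< rewrite τ-cell F 1≤r r≤p d< | ≤ᵇ-false (G+<-low a r d) = ≤ᵇ-false (≥1 a r d 1≤r r≤p d<)
      ... | high lt rewrite τ-high F 1≤r r≤p lt | ≤ᵇ-false (≤-<-trans (G≤B a r 1≤r r≤p) lt) = refl
      final′ : ∀ a r j → 1 ≤ r → r ≤ p a → (τ F a r j ≤ᵇ n) ≡ (j ≤ᵇ B a r)
      final′ a r j 1≤r r≤p with locate a r 1≤r r≤p j
      ... | low le  rewrite τ-low F le | ≤ᵇ-true (≤-trans le (G≤B a r 1≤r r≤p)) = refl
      ... | cell d refl d< rewrite τ-cell F 1≤r r≤p d< | ≤ᵇ-true (≤n a r d 1≤r r≤p d<) =
        sym (≤ᵇ-true (subst (G a r + suc d ≤_) (sym (B≡G+size a r 1≤r r≤p)) (+-monoʳ-≤ (G a r) d<)))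
      ... | high lt rewrite τ-high F 1≤r r≤p lt | ≤ᵇ-false lt = ≤ᵇ-false (n<1+n n)
      growth≤1′ : ∀ a e j → e < n → height F a (suc e) j ≤ suc (height F a e (suc j))
      growth≤1′ a e j e<n = ≤-bySections (cnt≤ _ (p a)) λ
        { 1 _ _ _ → s≤s z≤n
        ; (suc (suc r)) _ r<p q → s≤s (proj₂ (section a (suc r) (suc j) e (s≤s z≤n) (<⇒≤ r<p) (<⇒≤ e<n))
            (strict a (suc r) j e (s≤s z≤n) r<p e<n (proj₁ (section a (suc (suc r)) j (suc e) (s≤s z≤n) r<p e<n) q))) }

  -- Recovers a filling from its heights: τ F a r j is the number of e < n with e < τ F a r j, and
  -- e < τ F a r j says that fewer than r particles are in the columns ≥ j after e rows.
  tableau : (Fin k → ℕ → ℕ → ℕ) → Filling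
  tableau H a r c = cnt (λ e → H a (pred e) (G a r + (c ∸ part (γ a) r)) <ᵇ r) n

  Agree : Filling → Filling → Set
  Agree F F′ = ∀ a r d → 1 ≤ r → r ≤ p a → d < size a r →
    F a r (suc (part (γ a) r + d)) ≡ F′ a r (suc (part (γ a) r + d))

  tableau-cell : ∀ H a r d → tableau H a r (suc (part (γ a) r + d)) ≡ cnt (λ e → H a (pred e) (G a r + suc d) <ᵇ r) n
  tableau-cell H a r d = cong (λ c → cnt (λ e → H a (pred e) (G a r + c) <ᵇ r) n)
    (trans (cong (_∸ part (γ a) r) (sym (+-suc (part (γ a) r) d))) (m+n∸m≡n (part (γ a) r) (suc d)))

  filling≡tableau : ∀ {F} → Semistandard F → 1 ≤ n → ∀ {H} → (∀ a e j → e ≤ n → H a e j ≡ height F a e j) →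
    Agree F (tableau H)
  filling≡tableau {F} ss 1≤n {H} eq a r d 1≤r r≤p d< = trans
    (≡-bySections (Semistandard.≤n ss a r d 1≤r r≤p d<) (cnt≤ P′ n) bySection)
    (sym (tableau-cell H a r d))
    where
    open FromFilling ss 1≤n
    j = G a r + suc d
    v = F a r (suc (part (γ a) r + d))
    P′ : ℕ → Bool
    P′ e = H a (pred e) j <ᵇ r
    P′⇔ : ∀ e → suc e ≤ n → (T (P′ (suc e)) → suc e ≤ v) × (suc e ≤ v → T (P′ (suc e)))
    P′⇔ e e<n = (λ t → ≰⇒> λ v≤e → <⇒≱ (<ᵇ⇒< (H a e j) r t)
                    (subst (r ≤_) (sym (eq a e j (<⇒≤ e<n))) (proj₂ s (subst (_≤ e) (sym (τ-cell F 1≤r r≤p d<)) v≤e))))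
              , (λ lt → <⇒<ᵇ (≰⇒> λ r≤H → <⇒≱ lt
                    (subst (_≤ e) (τ-cell F 1≤r r≤p d<) (proj₁ s (subst (r ≤_) (eq a e j (<⇒≤ e<n)) r≤H)))))
      where s = section a r j e 1≤r r≤p (<⇒≤ e<n)
    down : DownClosed P′ n
    down (suc e) _ e<n t = proj₂ (P′⇔ e (<⇒≤ e<n)) (<⇒≤ (proj₁ (P′⇔ (suc e) e<n) t))
    bySection : ∀ e → 1 ≤ e → e ≤ n → (e ≤ v → e ≤ cnt P′ n) × (e ≤ cnt P′ n → e ≤ v)
    bySection (suc e) _ e<n = (λ q → proj₂ c (proj₂ (P′⇔ e e<n) q)) , (λ q → proj₁ (P′⇔ e e<n) (proj₁ c q))
      where c = cnt-downClosed P′ n down (suc e) (s≤s z≤n) e<n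

  module FromHeights {H : Fin k → ℕ → ℕ → ℕ} (hs : Heights H) {F : Filling} (agree : Agree F (tableau H)) where
    open Heights hs

    H-mono : ∀ a {e e′} j → e ≤ e′ → e′ ≤ n → H a e j ≤ H a e′ j
    H-mono = heights-mono hs

    section : ∀ a r j e → 1 ≤ r → r ≤ p a → e ≤ n → (r ≤ H a e j → τ F a r j ≤ e) × (τ F a r j ≤ e → r ≤ H a e j)
    section a r j e 1≤r r≤p e≤n with locate a r 1≤r r≤p j
    ... | low le = (λ _ → subst (_≤ e) (sym (τ-low F le)) z≤n)
                 , (λ _ → ≤-trans (subst (r ≤_) (sym (initial a j)) (proj₂ (heightγ-section a r j 1≤r r≤p) le)) (H-mono a j z≤n e≤n))
    ... | high lt = (λ q → ⊥-elim (<⇒≱ lt (proj₁ (heightβ-section a r j 1≤r r≤p)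
                       (subst (r ≤_) (final a j) (≤-trans q (H-mono a j e≤n ≤-refl))))))
                  , (λ q → ⊥-elim (<⇒≱ (s≤s e≤n) (subst (_≤ e) (τ-high F 1≤r r≤p lt) q)))
    ... | cell d refl d< rewrite τ-cell F 1≤r r≤p d< | agree a r d 1≤r r≤p d< | tableau-cell H a r d with m≤n⇒m<n∨m≡n e≤n
    ...   | inj₂ refl = (λ _ → cnt≤ _ n)
                      , (λ _ → subst (r ≤_) (sym (final a j′)) (proj₂ (heightβ-section a r j′ 1≤r r≤p)
                          (subst (j′ ≤_) (sym (B≡G+size a r 1≤r r≤p)) (+-monoʳ-≤ (G a r) d<))))
      where j′ = G a r + suc d
    ...   | inj₁ e<n = (λ r≤H → ≮⇒≥ λ lt → ≤⇒≯ r≤H (<ᵇ⇒< (H a e j′) r (proj₁ c lt)))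
                     , (λ le → ≮⇒≥ λ lt → ≤⇒≯ le (proj₂ c (<⇒<ᵇ lt)))
      where
      j′ = G a r + suc d
      down : DownClosed (λ e → H a (pred e) j′ <ᵇ r) n
      down (suc e) _ e<n t = <⇒<ᵇ (≤-<-trans (grow a e j′ (<⇒≤ e<n)) (<ᵇ⇒< (H a (suc e) j′) r t))
      c = cnt-downClosed (λ e → H a (pred e) j′ <ᵇ r) n down (suc e) (s≤s z≤n) e<n

    τ≤1+n : ∀ a r j → 1 ≤ r → r ≤ p a → τ F a r j ≤ suc n
    τ≤1+n a r j 1≤r r≤p with locate a r 1≤r r≤p j
    ... | low le = subst (_≤ suc n) (sym (τ-low F le)) z≤n
    ... | high lt = ≤-reflexive (τ-high F 1≤r r≤p lt)
    ... | cell d refl d< = subst (_≤ suc n) (sym (trans (τ-cell F 1≤r r≤p d<) (trans (agree a r d 1≤r r≤p d<) (tableau-cell H a r d))))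
                        (m≤n⇒m≤1+n (cnt≤ _ n))

    tableau-semistandard : Semistandard F
    tableau-semistandard = record
      { ≥1 = λ a r d 1≤r r≤p d< → ≰⇒> λ le → <⇒≱ (G+<-low a r d) (proj₁ (heightγ-section a r _ 1≤r r≤p)
          (subst (r ≤_) (initial a _) (proj₂ (section a r (G a r + suc d) 0 1≤r r≤p z≤n) (subst (_≤ 0) (sym (τ-cell F 1≤r r≤p d<)) le))))
      ; ≤n = λ a r d 1≤r r≤p d< → subst (_≤ n) (sym (trans (agree a r d 1≤r r≤p d<) (tableau-cell H a r d))) (cnt≤ _ n)
      ; weak = weak′
      ; strict = λ a r j e 1≤r r<p e<n q → proj₁ (section a r (suc j) e 1≤r (<⇒≤ r<p) (<⇒≤ e<n))
          (s≤s⁻¹ (≤-trans (proj₂ (section a (suc r) j (suc e) (s≤s z≤n) r<p e<n) q) (growth≤1 a e j e<n)))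
      }
      where
      weak′ : ∀ a r j → 1 ≤ r → r ≤ p a → τ F a r j ≤ τ F a r (suc j)
      weak′ a r j 1≤r r≤p with τ F a r (suc j) ≤? n
      ... | yes le = proj₁ (section a r j _ 1≤r r≤p le) (≤-trans (proj₂ (section a r (suc j) _ 1≤r r≤p le) ≤-refl) (antitone a _ j))
      ... | no gt  = ≤-trans (τ≤1+n a r j 1≤r r≤p) (≰⇒> gt)

    height≡H : ∀ a e j → 1 ≤ n → e ≤ n → height F a e j ≡ H a e j
    height≡H a e j 1≤n e≤n = ≡-bySections (cnt≤ _ (p a)) H≤p λ r 1≤r r≤p →
      (λ q → proj₂ (section a r j e 1≤r r≤p e≤n) (proj₁ (FromFilling.section tableau-semistandard 1≤n a r j e 1≤r r≤p e≤n) q)) ,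
      (λ q → proj₂ (FromFilling.section tableau-semistandard 1≤n a r j e 1≤r r≤p e≤n) (proj₁ (section a r j e 1≤r r≤p e≤n) q))
      where
      H≤p : H a e j ≤ p a
      H≤p = ≤-trans (H-mono a j e≤n ≤-refl) (subst (_≤ p a) (sym (final a j)) (cnt≤ _ (p a)))

T-⇒ : ∀ {a b} → (T a → T b) → T (not a ∨ b)
T-⇒ {true}  f = f tt
T-⇒ {false} f = tt

T-⇒⁻ : ∀ {a b} → T (not a ∨ b) → T a → T b
T-⇒⁻ {true} t _ = t

∈-range⁻ : ∀ {lo hi c} → c ∈ range lo hi → ∃ λ d → d < hi ∸ lo × c ≡ suc (lo + d)
∈-range⁻ {lo} m with ∈-map⁻ (λ i → suc (lo + i)) m
... | d , d∈ , eq = d , ∈-upTo⁻ d∈ , eq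

∈-range⁺ : ∀ {lo hi d} → d < hi ∸ lo → suc (lo + d) ∈ range lo hi
∈-range⁺ {lo} d< = ∈-map⁺ (λ i → suc (lo + i)) (∈-upTo⁺ d<)

⊖-injective : ∀ c r c′ r′ → pos c ℤ.- pos r ≡ pos c′ ℤ.- pos r′ → c + r′ ≡ c′ + r
⊖-injective c r c′ r′ eq = ℤ.+-injective (begin
  pos (c + r′)                     ≡⟨ ℤ.pos-+ c r′ ⟩
  pos c ℤ.+ pos r′                   ≡⟨ cong (λ z → z ℤ.+ pos r′) (cancel (pos c) (pos r)) ⟨
  pos c ℤ.- pos r ℤ.+ pos r ℤ.+ pos r′   ≡⟨ cong (λ z → z ℤ.+ pos r ℤ.+ pos r′) eq ⟩
  pos c′ ℤ.- pos r′ ℤ.+ pos r ℤ.+ pos r′ ≡⟨ ℤ.+-assoc (pos c′ ℤ.- pos r′) (pos r) (pos r′) ⟩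
  pos c′ ℤ.- pos r′ ℤ.+ (pos r ℤ.+ pos r′) ≡⟨ cong (λ z → pos c′ ℤ.- pos r′ ℤ.+ z) (ℤ.+-comm (pos r) (pos r′)) ⟩
  pos c′ ℤ.- pos r′ ℤ.+ (pos r′ ℤ.+ pos r) ≡⟨ ℤ.+-assoc (pos c′ ℤ.- pos r′) (pos r′) (pos r) ⟨
  pos c′ ℤ.- pos r′ ℤ.+ pos r′ ℤ.+ pos r ≡⟨ cong (λ z → z ℤ.+ pos r) (cancel (pos c′) (pos r′)) ⟩
  pos c′ ℤ.+ pos r                   ≡⟨ ℤ.pos-+ c′ r ⟨
  pos (c′ + r)                     ∎)
  where
  open ≡-Reasoning
  cancel : ∀ i j → i ℤ.- j ℤ.+ j ≡ i
  cancel i j = trans (ℤ.+-assoc i (ℤ.- j) j) (trans (cong (λ z → i ℤ.+ z) (ℤ.+-inverseˡ j)) (ℤ.+-identityʳ i))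

⊖-cong : ∀ c r c′ r′ → c + r′ ≡ c′ + r → pos c ℤ.- pos r ≡ pos c′ ℤ.- pos r′
⊖-cong c r c′ r′ eq = begin
  pos c ℤ.- pos r                ≡⟨ ℤ.m-n≡m⊖n c r ⟩
  c ℤ.⊖ r                    ≡⟨ ℤ.+-cancelˡ-⊖ r′ c r ⟨
  (r′ + c) ℤ.⊖ (r′ + r)      ≡⟨ cong₂ ℤ._⊖_ (trans (+-comm r′ c) (trans eq (+-comm c′ r))) (+-comm r′ r) ⟩
  (r + c′) ℤ.⊖ (r + r′)      ≡⟨ ℤ.+-cancelˡ-⊖ r c′ r′ ⟩
  c′ ℤ.⊖ r′                  ≡⟨ ℤ.m-n≡m⊖n c′ r′ ⟨
  pos c′ ℤ.- pos r′              ∎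
  where open ≡-Reasoning

module Triples {k : ℕ} {β γ : Fin k → List ℕ} (C : Coordinates β γ) (n : ℕ) where
  open Coordinates C
  open Shape β γ
  open Tableau C n

  inShape⁺ : ∀ a r c → 1 ≤ r → r ≤ p a → part (γ a) r < c → c ≤ part (β a) r → inShape a r c ≡ true
  inShape⁺ a r c 1≤r r≤p lt le rewrite ≤ᵇ-true 1≤r | ≤ᵇ-true r≤p | <ᵇ-true lt | ≤ᵇ-true le = refl

  inShape⁻ : ∀ a r c → T (inShape a r c) → (1 ≤ r × r ≤ p a) × (part (γ a) r < c × c ≤ part (β a) r)
  inShape⁻ a r c t with T-∧⁻ (1 ≤ᵇ r) t
  ... | t₁ , u₁ with T-∧⁻ (r ≤ᵇ p a) u₁
  ...   | t₂ , u₂ with T-∧⁻ (part (γ a) r <ᵇ c) u₂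
  ...     | t₃ , t₄ = (≤ᵇ⇒≤ 1 r t₁ , ≤ᵇ⇒≤ r _ t₂) , (<ᵇ⇒< _ c t₃ , ≤ᵇ⇒≤ c _ t₄)

  size-≤ : ∀ a r d → 1 ≤ r → r ≤ p a → d < size a r → suc (part (γ a) r + d) ≤ part (β a) r
  size-≤ a r d 1≤r r≤p d< = subst₂ _≤_ (+-suc (part (γ a) r) d) (m+[n∸m]≡n (γ≤β a r 1≤r r≤p)) (+-monoʳ-≤ (part (γ a) r) d<)

  size-<⁻ : ∀ a r d → 1 ≤ r → r ≤ p a → suc (part (γ a) r + d) ≤ part (β a) r → d < size a r
  size-<⁻ a r d 1≤r r≤p le = +-cancelˡ-≤ (part (γ a) r) (suc d) (size a r)
    (subst₂ _≤_ (sym (+-suc (part (γ a) r) d)) (sym (m+[n∸m]≡n (γ≤β a r 1≤r r≤p))) le)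

  inShape-cell : ∀ a r d → 1 ≤ r → r ≤ p a → d < size a r → inShape a r (suc (part (γ a) r + d)) ≡ true
  inShape-cell a r d 1≤r r≤p d< = inShape⁺ a r _ 1≤r r≤p (s≤s (m≤m+n _ d)) (size-≤ a r d 1≤r r≤p d<)

  inShape-cell⁻ : ∀ a r c → T (inShape a r c) → ∃ λ d → d < size a r × c ≡ suc (part (γ a) r + d)
  inShape-cell⁻ a r c t with inShape⁻ a r c t
  ... | (1≤r , r≤p) , (lt , le) = c ∸ suc (part (γ a) r) , size-<⁻ a r _ 1≤r r≤p (subst (_≤ part (β a) r) eq le) , eq
    where
    eq : c ≡ suc (part (γ a) r + (c ∸ suc (part (γ a) r)))
    eq = sym (m+[n∸m]≡n lt)

  column : ∀ a r d → 1 ≤ r → r ≤ p a → (G a r + d) + (r + P) ≡ (part (γ a) r + d) + Q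
  column a r d 1≤r r≤p = begin
    G a r + d + (r + P)      ≡⟨ +-assoc (G a r) d _ ⟩
    G a r + (d + (r + P))    ≡⟨ cong (G a r +_) (+-comm d _) ⟩
    G a r + (r + P + d)      ≡⟨ +-assoc (G a r) (r + P) d ⟨
    G a r + (r + P) + d      ≡⟨ cong (_+ d) (G-shift a r 1≤r r≤p) ⟩
    part (γ a) r + Q + d     ≡⟨ +-assoc (part (γ a) r) Q d ⟩
    part (γ a) r + (Q + d)   ≡⟨ cong (part (γ a) r +_) (+-comm Q d) ⟩
    part (γ a) r + (d + Q)   ≡⟨ +-assoc (part (γ a) r) d Q ⟨
    part (γ a) r + d + Q     ∎
    where open ≡-Reasoning

  column-below : ∀ a r d d′ → 1 ≤ r → suc r ≤ p a →
    (G a r + d ≡ suc (G a (suc r) + d′) → part (γ a) r + d ≡ part (γ a) (suc r) + d′) ×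
    (part (γ a) r + d ≡ part (γ a) (suc r) + d′ → G a r + d ≡ suc (G a (suc r) + d′))
  column-below a r d d′ 1≤r r<p =
      (λ eq → +-cancelʳ-≡ Q _ _ (trans (sym here′) (trans (cong (_+ (r + P)) eq) (trans (sym (+-suc _ (r + P))) there′))))
    , (λ eq → +-cancelʳ-≡ (r + P) _ _ (trans here′ (trans (cong (_+ Q) eq) (trans (sym there′) (+-suc _ (r + P))))))
    where
    here′ = column a r d 1≤r (<⇒≤ r<p)
    there′ = column a (suc r) d′ (s≤s z≤n) r<p

  content≡ : ∀ a r d b r′ d′ → 1 ≤ r → r ≤ p a → 1 ≤ r′ → r′ ≤ p b →
    (content r (suc (part (γ a) r + d)) ≡ content r′ (suc (part (γ b) r′ + d′)) → G a r + d ≡ G b r′ + d′) ×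
    (G a r + d ≡ G b r′ + d′ → content r (suc (part (γ a) r + d)) ≡ content r′ (suc (part (γ b) r′ + d′)))
  content≡ a r d b r′ d′ 1≤r r≤p 1≤r′ r′≤p =
      (λ eq → +-cancelʳ-≡ (r + P + r′) _ _ (trans (move a r d r′ 1≤r r≤p)
        (trans (cong (_+ Q) (suc-injective (⊖-injective _ r _ r′ eq))) (trans (sym (move b r′ d′ r 1≤r′ r′≤p)) (cong (_+_ (G b r′ + d′)) flip)))))
    , (λ eq → ⊖-cong _ r _ r′ (cong suc (+-cancelʳ-≡ Q _ _ (trans (sym (move a r d r′ 1≤r r≤p))
        (trans (cong₂ _+_ eq (sym flip)) (move b r′ d′ r 1≤r′ r′≤p))))))
    where
    open ≡-Reasoning
    flip : r′ + P + r ≡ r + P + r′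
    flip = trans (+-comm (r′ + P) r) (trans (cong (r +_) (+-comm r′ P)) (sym (+-assoc r P r′)))
    move : ∀ a r d s → 1 ≤ r → r ≤ p a → (G a r + d) + (r + P + s) ≡ (part (γ a) r + d + s) + Q
    move a r d s 1≤r r≤p = begin
      (G a r + d) + (r + P + s)    ≡⟨ +-assoc (G a r + d) (r + P) s ⟨
      (G a r + d) + (r + P) + s    ≡⟨ cong (_+ s) (column a r d 1≤r r≤p) ⟩
      (part (γ a) r + d) + Q + s   ≡⟨ +-assoc (part (γ a) r + d) Q s ⟩
      (part (γ a) r + d) + (Q + s) ≡⟨ cong (part (γ a) r + d +_) (+-comm Q s) ⟩
      (part (γ a) r + d) + (s + Q) ≡⟨ +-assoc (part (γ a) r + d) s Q ⟨
      (part (γ a) r + d + s) + Q   ∎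

  τ-next : ∀ F {a r d} → 1 ≤ r → r ≤ p a → suc d < size a r →
    τ F a r (suc (G a r + suc d)) ≡ F a r (suc (suc (part (γ a) r + d)))
  τ-next F {a} {r} {d} 1≤r r≤p d< = trans (cong (τ F a r) (sym (+-suc (G a r) (suc d))))
    (trans (τ-cell F 1≤r r≤p d<) (cong (λ c → F a r (suc c)) (+-suc (part (γ a) r) d)))

  InRange : Filling → Set
  InRange F = ∀ {a r c} → (a , r , c) ∈ allCells → 1 ≤ F a r c × F a r c ≤ n

  ∈-allCells : ∀ a r d → 1 ≤ r → r ≤ p a → d < size a r → (a , r , suc (part (γ a) r + d)) ∈ allCells
  ∈-allCells a r d 1≤r r≤p d< = ∈-concatMap (λ a → map (λ rc → (a , rc)) (cells a)) (∈-allFin a)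
    (∈-map⁺ (λ rc → (a , rc)) (∈-concatMap (λ r → map (λ c → (r , c)) (range (part (γ a) r) (part (β a) r)))
      (∈-rows⁺ 1≤r r≤p) (∈-map⁺ (λ c → (r , c)) (∈-range⁺ d<))))

  ∈-cells⁻ : ∀ a {r c} → (r , c) ∈ cells a →
    (1 ≤ r × r ≤ p a) × (∃ λ d → d < size a r × c ≡ suc (part (γ a) r + d))
  ∈-cells⁻ a m with ∈-concatMap⁻ (λ r → map (λ c → (r , c)) (range (part (γ a) r) (part (β a) r))) (rows a) m
  ... | r , r∈ , q with ∈-map⁻ (λ c → (r , c)) q
  ...   | c , c∈ , refl = ∈-rows⁻ r∈ , ∈-range⁻ c∈

  ∈-allCells⁻ : ∀ {a r c} → (a , r , c) ∈ allCells →
    (1 ≤ r × r ≤ p a) × (∃ λ d → d < size a r × c ≡ suc (part (γ a) r + d))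
  ∈-allCells⁻ m with ∈-concatMap⁻ (λ a → map (λ rc → (a , rc)) (cells a)) (allFin k) m
  ... | a , _ , q with ∈-map⁻ (λ rc → (a , rc)) q
  ...   | _ , rc∈ , refl = ∈-cells⁻ a rc∈

  allCells-unique : Unique allCells
  allCells-unique = concatMap-unique (λ a → map (λ rc → (a , rc)) (cells a)) proj₁ fst
    (λ a → Unique.map⁺ (λ { refl → refl }) (cells-unique a)) (Unique.allFin⁺ k)
    where
    fst : ∀ {a y} → y ∈ map (λ rc → (a , rc)) (cells a) → proj₁ y ≡ a
    fst {a} m with ∈-map⁻ (λ rc → (a , rc)) m
    ... | _ , _ , refl = refl
    fst′ : ∀ a {r y} → y ∈ map (λ c → (r , c)) (range (part (γ a) r) (part (β a) r)) → proj₁ y ≡ r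
    fst′ a {r} m with ∈-map⁻ (λ c → (r , c)) m
    ... | _ , _ , refl = refl
    cells-unique : ∀ a → Unique (cells a)
    cells-unique a = concatMap-unique (λ r → map (λ c → (r , c)) (range (part (γ a) r) (part (β a) r))) proj₁ (fst′ a)
      (λ r → Unique.map⁺ (λ { refl → refl }) (Unique.map⁺ (λ eq → +-cancelˡ-≡ (part (γ a) r) _ _ (suc-injective eq)) (Unique.upTo⁺ _)))
      (rows-unique (p a))

  module _ (F : Filling) where

    semistandard⇒ : InRange F → T (semistandard F) → Semistandard F
    semistandard⇒ inR t = record
      { ≥1 = λ a r d 1≤r r≤p d< → proj₁ (inR (∈-allCells a r d 1≤r r≤p d<))
      ; ≤n = λ a r d 1≤r r≤p d< → proj₂ (inR (∈-allCells a r d 1≤r r≤p d<))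
      ; weak = weak
      ; strict = strict
      }
      where
      ok : ∀ a r d → 1 ≤ r → r ≤ p a → d < size a r → let c = suc (part (γ a) r + d) in
        T (not (inShape a r (suc c)) ∨ (F a r c ≤ᵇ F a r (suc c))) × T (not (inShape a (suc r) c) ∨ (F a r c <ᵇ F a (suc r) c))
      ok a r d 1≤r r≤p d< = T-∧⁻ _ (allL⁻ t (∈-allCells a r d 1≤r r≤p d<))
      weak : ∀ a r j → 1 ≤ r → r ≤ p a → τ F a r j ≤ τ F a r (suc j)
      weak a r j 1≤r r≤p with locate a r 1≤r r≤p j
      ... | low le  rewrite τ-low F le = z≤n
      ... | high lt rewrite τ-high F 1≤r r≤p lt | τ-high F 1≤r r≤p (m≤n⇒m≤1+n lt) = ≤-refl
      ... | cell d refl d< rewrite τ-cell F 1≤r r≤p d< with suc d <? size a r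
      ...   | yes d′< = subst (F a r (suc (part (γ a) r + d)) ≤_) (sym (τ-next F 1≤r r≤p d′<))
        (≤ᵇ⇒≤ _ _ (T-⇒⁻ (proj₁ (ok a r d 1≤r r≤p d<)) (subst (λ c → T (inShape a r (suc c))) (+-suc (part (γ a) r) d)
          (subst T (sym (inShape-cell a r (suc d) 1≤r r≤p d′<)) tt))))
      ...   | no ¬d′< rewrite τ-high F {a} {r} {suc (G a r + suc d)} 1≤r r≤p
                (s≤s (subst (_≤ G a r + suc d) (sym (B≡G+size a r 1≤r r≤p)) (+-monoʳ-≤ (G a r) (≮⇒≥ ¬d′<)))) =
        m≤n⇒m≤1+n (proj₂ (inR (∈-allCells a r d 1≤r r≤p d<)))
      strict : ∀ a r j e → 1 ≤ r → suc r ≤ p a → suc e ≤ n → τ F a (suc r) j ≤ suc e → τ F a r (suc j) ≤ e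
      strict a r j e 1≤r r<p e<n q with locate a (suc r) (s≤s z≤n) r<p j
      ... | low le  rewrite τ-low F {a} {r} {suc j} (≤-trans (s≤s le) (G-decreasing a r 1≤r r<p)) = z≤n
      ... | high lt rewrite τ-high F (s≤s z≤n) r<p lt = ⊥-elim (<⇒≱ e<n (s≤s⁻¹ q))
      ... | cell d refl d< with locate a r 1≤r (<⇒≤ r<p) (suc j)
      ...   | low le rewrite τ-low F {a} {r} {suc j} le = z≤n
      ...   | high lt = ⊥-elim (<⇒≱ lt (≤-trans (s≤s (subst (j ≤_) (sym (B≡G+size a (suc r) (s≤s z≤n) r<p)) (+-monoʳ-≤ (G a (suc r)) d<)))
                          (B-decreasing a r 1≤r r<p)))
      ...   | cell d′ eq d′< = subst (_≤ e) (sym (trans (cong (τ F a r) eq) (τ-cell F 1≤r (<⇒≤ r<p) d′<))) (s≤s⁻¹ (≤-trans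
        (<ᵇ⇒< _ _ (T-⇒⁻ (proj₂ (ok a r d′ 1≤r (<⇒≤ r<p) d′<))
          (subst (λ c → T (inShape a (suc r) c)) (sym same) (subst T (sym (inShape-cell a (suc r) d (s≤s z≤n) r<p d<)) tt))))
        (subst (λ c → F a (suc r) c ≤ suc e) (sym same) (subst (_≤ suc e) (τ-cell F (s≤s z≤n) r<p d<) q))))
        where
        same : suc (part (γ a) r + d′) ≡ suc (part (γ a) (suc r) + d)
        same = trans (sym (+-suc _ d′)) (trans (proj₁ (column-below a r (suc d′) (suc d) 1≤r r<p) (sym eq)) (+-suc _ d))

    semistandard⇐ : Semistandard F → T (semistandard F)
    semistandard⇐ ss = allL⁺ allCells λ {u} → ok {u}
      where
      open Semistandard ss
      ok : ∀ {u : Fin k × ℕ × ℕ} → u ∈ allCells → let (a , r , c) = u in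
        T ((not (inShape a r (suc c)) ∨ (F a r c ≤ᵇ F a r (suc c))) ∧ (not (inShape a (suc r) c) ∨ (F a r c <ᵇ F a (suc r) c)))
      ok {a , r , c} u∈ with ∈-allCells⁻ u∈
      ... | (1≤r , r≤p) , d , d< , refl = T-∧⁺ (T-⇒ {inShape a r (suc c)} right) (T-⇒ {inShape a (suc r) c} up)
        where
        right : T (inShape a r (suc c)) → T (F a r c ≤ᵇ F a r (suc c))
        right t = ≤⇒≤ᵇ (subst₂ _≤_ (τ-cell F 1≤r r≤p d<)
          (τ-next F 1≤r r≤p d′<)
          (weak a r (G a r + suc d) 1≤r r≤p))
          where
          d′< : suc d < size a r
          d′< = size-<⁻ a r (suc d) 1≤r r≤p (subst (_≤ part (β a) r) (cong suc (sym (+-suc (part (γ a) r) d)))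
                  (proj₂ (proj₂ (inShape⁻ a r (suc c) t))))
        up : T (inShape a (suc r) c) → T (F a r c <ᵇ F a (suc r) c)
        up t with inShape-cell⁻ a (suc r) c t | inShape⁻ a (suc r) c t
        ... | d′ , d′< , eq | (_ , r<p) , _ = <⇒<ᵇ (subst (suc (F a r c) ≤_) vEq (subst (_≤ suc e) (cong suc (trans (cong (τ F a r) j≡) (τ-cell F 1≤r r≤p d<))) (s≤s below)))
          where
          v = F a (suc r) (suc (part (γ a) (suc r) + d′))
          e = pred v
          e≡ : suc e ≡ v
          e≡ = suc-pred v ⦃ >-nonZero (≥1 a (suc r) d′ (s≤s z≤n) r<p d′<) ⦄
          vEq : suc e ≡ F a (suc r) c
          vEq = trans e≡ (cong (F a (suc r)) (sym eq))
          j≡ : suc (G a (suc r) + suc d′) ≡ G a r + suc d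
          j≡ = sym (proj₂ (column-below a r (suc d) (suc d′) 1≤r r<p)
                 (trans (+-suc _ d) (trans eq (sym (+-suc _ d′)))))
          below : τ F a r (suc (G a (suc r) + suc d′)) ≤ e
          below = strict a r _ e 1≤r r<p (subst (_≤ n) (sym e≡) (≤n a (suc r) d′ (s≤s z≤n) r<p d′<))
            (≤-reflexive (trans (τ-cell F (s≤s z≤n) r<p d′<) (sym e≡)))

module Conf {k : ℕ} {β γ : Fin k → List ℕ} (C : Coordinates β γ) (n : ℕ) where
  open Coordinates C
  open Shape β γ
  open Tableau C n
  open Triples C n

  isTriple : Filling → Fin k → ℕ → ℕ → ℕ → Bool
  isTriple F b v i r = (τ F b r i ≤ᵇ v) ∧ (v ≤ᵇ τ F b r (suc i))

  triples : Filling → Fin k → ℕ → ℕ → ℕ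
  triples F b v i = cnt (isTriple F b v i) (p b)

  sameContent : ∀ a r d b r′ d′ → 1 ≤ r → r ≤ p a → 1 ≤ r′ → r′ ≤ p b →
    ⌊ content r (suc (part (γ a) r + d)) ℤ.≟ content r′ (suc (part (γ b) r′ + d′)) ⌋ ≡ (G a r + d ≡ᵇ G b r′ + d′)
  sameContent a r d b r′ d′ 1≤r r≤p 1≤r′ r′≤p
    with content r (suc (part (γ a) r + d)) ℤ.≟ content r′ (suc (part (γ b) r′ + d′))
       | content≡ a r d b r′ d′ 1≤r r≤p 1≤r′ r′≤p
  ... | yes eq | f , _ = sym (T⇒≡true (≡⇒≡ᵇ _ _ (f eq)))
  ... | no neq | _ , g = sym (¬T⇒≡false (λ t → neq (g (≡ᵇ⇒≡ _ _ t))))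

  entryᵘ : ∀ F b r d → 1 ≤ r → r ≤ p b → d ≤ size b r →
    (if inShape b r (part (γ b) r + d) then F b r (part (γ b) r + d) else 0) ≡ τ F b r (G b r + d)
  entryᵘ F b r zero 1≤r r≤p _
    rewrite ¬T⇒≡false {inShape b r (part (γ b) r + 0)} (λ t → <-irrefl (sym (+-identityʳ _)) (proj₁ (proj₂ (inShape⁻ b r _ t)))) =
    sym (τ-low F (≤-reflexive (+-identityʳ (G b r))))
  entryᵘ F b r (suc d) 1≤r r≤p d<
    rewrite +-suc (part (γ b) r) d | inShape-cell b r d 1≤r r≤p d< = sym (τ-cell F 1≤r r≤p d<)

  entryʷ : ∀ F b r d v → 1 ≤ r → r ≤ p b → d ≤ size b r → v ≤ n →
    (if inShape b r (suc (part (γ b) r + d)) then v ≤ᵇ F b r (suc (part (γ b) r + d)) else true)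
      ≡ (v ≤ᵇ τ F b r (suc (G b r + d)))
  entryʷ F b r d v 1≤r r≤p d≤ v≤n with m≤n⇒m<n∨m≡n d≤
  ... | inj₁ d< rewrite inShape-cell b r d 1≤r r≤p d< =
    cong (v ≤ᵇ_) (trans (sym (τ-cell F 1≤r r≤p d<)) (cong (τ F b r) (+-suc (G b r) d)))
  ... | inj₂ refl
    rewrite ¬T⇒≡false {inShape b r (suc (part (γ b) r + d))} (λ t → <-irrefl refl (size-<⁻ b r d 1≤r r≤p (proj₂ (proj₂ (inShape⁻ b r _ t))))) =
    sym (trans (cong (v ≤ᵇ_) (τ-high F 1≤r r≤p (s≤s (≤-reflexive (B≡G+size b r 1≤r r≤p))))) (≤ᵇ-true (m≤n⇒m≤1+n v≤n)))

  -- No triple is missed by restricting w to the columns γ_r + 1, …, β_r + 1: further left w has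
  -- entry 0 < v, and further right u has entry n + 1 > v.
  triple-count : ∀ F a r d b r′ → 1 ≤ r → r ≤ p a → 1 ≤ r′ → r′ ≤ p b →
    let c = suc (part (γ a) r + d) in 1 ≤ F a r c → F a r c ≤ n →
    countL (λ c′ → ⌊ content r′ c′ ℤ.≟ content r c ⌋ ∧ coinvCond F a r c b r′ c′) (wCols b r′)
      ≡ b2n (isTriple F b (F a r c) (G a r + d) r′)
  triple-count F a r d b r′ 1≤r r≤p 1≤r′ r′≤p 1≤v v≤n = begin
    countL χ (wCols b r′)                                       ≡⟨ countL≡∑ χ (wCols b r′) ⟩
    ∑ (wCols b r′) (b2n ∘ χ)                                    ≡⟨ ∑-map (λ d′ → suc (g + d′)) (upTo (suc (part (β b) r′) ∸ g)) (b2n ∘ χ) ⟩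
    ∑ (upTo (suc (part (β b) r′) ∸ g)) (λ d′ → b2n (χ (suc (g + d′)))) ≡⟨ cong (λ m → ∑ (upTo m) (λ d′ → b2n (χ (suc (g + d′))))) (+-∸-assoc 1 (γ≤β b r′ 1≤r′ r′≤p)) ⟩
    ∑ (upTo (suc (size b r′))) (λ d′ → b2n (χ (suc (g + d′))))  ≡⟨ ∑-cong (upTo (suc (size b r′))) term ⟩
    ∑ (upTo (suc (size b r′))) δ               ≡⟨ total ⟩
    b2n (isTriple F b v i r′)                  ∎
    where
    open ≡-Reasoning
    c = suc (part (γ a) r + d)
    v = F a r c
    i = G a r + d
    g = part (γ b) r′
    χ : ℕ → Bool
    χ c′ = ⌊ content r′ c′ ℤ.≟ content r c ⌋ ∧ coinvCond F a r c b r′ c′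
    δ : ℕ → ℕ
    δ d′ = b2n ((G b r′ + d′ ≡ᵇ i) ∧ isTriple F b v (G b r′ + d′) r′)
    term : ∀ {d′} → d′ ∈ upTo (suc (size b r′)) →
      b2n (χ (suc (g + d′))) ≡ δ d′
    term {d′} d′∈ = cong b2n (cong₂ _∧_ (sameContent b r′ d′ a r d 1≤r′ r′≤p 1≤r r≤p)
      (cong₂ _∧_ (cong (_≤ᵇ v) (entryᵘ F b r′ d′ 1≤r′ r′≤p d′≤)) (entryʷ F b r′ d′ v 1≤r′ r′≤p d′≤ v≤n)))
      where d′≤ = s≤s⁻¹ (∈-upTo⁻ d′∈)
    vanish : ∀ d′ → G b r′ + d′ ≢ i → δ d′ ≡ 0
    vanish d′ neq rewrite ¬T⇒≡false {G b r′ + d′ ≡ᵇ i} (λ t → neq (≡ᵇ⇒≡ _ _ t)) = refl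
    total : ∑ (upTo (suc (size b r′))) δ ≡ b2n (isTriple F b v i r′)
    total with G b r′ ≤? i
    ... | no i<G = trans (∑-zero (upTo (suc (size b r′))) λ {d′} _ → vanish d′ (λ eq → i<G (subst (G b r′ ≤_) eq (m≤m+n _ d′))))
      (cong b2n (sym (trans (cong (λ m → (τ F b r′ i ≤ᵇ v) ∧ (v ≤ᵇ m)) (τ-low F (≰⇒> i<G)))
        (¬T⇒≡false (λ t → <⇒≱ 1≤v (≤ᵇ⇒≤ v 0 (proj₂ (T-∧⁻ (τ F b r′ i ≤ᵇ v) t))))))))
    ... | yes G≤i = atOffset (i ∸ G b r′) (m+[n∸m]≡n G≤i)
      where
      atOffset : ∀ d₀ → G b r′ + d₀ ≡ i → ∑ (upTo (suc (size b r′))) δ ≡ b2n (isTriple F b v i r′)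
      atOffset d₀ eq with d₀ ≤? size b r′
      ... | yes d₀≤ = trans (∑-single {f = δ} (Unique.upTo⁺ _) (∈-upTo⁺ (s≤s d₀≤))
        (λ {d′} _ neq → vanish d′ (λ e → neq (+-cancelˡ-≡ (G b r′) d′ d₀ (trans e (sym eq))))))
        (cong b2n (trans (cong (_∧ isTriple F b v (G b r′ + d₀) r′) (T⇒≡true (≡⇒≡ᵇ _ _ eq))) (cong (λ m → isTriple F b v m r′) eq)))
      ... | no d₀> = trans (∑-zero (upTo (suc (size b r′))) λ {d′} d′∈ → vanish d′ (λ e → d₀> (subst (_≤ size b r′)
          (+-cancelˡ-≡ (G b r′) d′ d₀ (trans e (sym eq))) (s≤s⁻¹ (∈-upTo⁻ d′∈)))))
        (cong b2n (sym (¬T⇒≡false (λ t → <⇒≱ (s≤s v≤n) (subst (_≤ v) (τ-high F 1≤r′ r′≤p B<i) (≤ᵇ⇒≤ _ v (proj₁ (T-∧⁻ (τ F b r′ i ≤ᵇ v) t))))))))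
        where
        B<i : B b r′ < i
        B<i = subst₂ _<_ (sym (B≡G+size b r′ 1≤r′ r′≤p)) eq (+-monoʳ-< (G b r′) (≰⇒> d₀>))

  module Cells {ℓ₁ ℓ₂ : Level} (M : CommutativeMonoid ℓ₁ ℓ₂) where
    open CommutativeMonoid M using (Carrier; _≈_) renaming (trans to ≈-trans; reflexive to ≈-reflexive)
    open BigOp M

    ⨁-cells : ∀ a (f : ℕ × ℕ → Carrier) →
      ⨁ (cells a) f ≈ ⨁ (rows a) (λ r → ⨁ (upTo (size a r)) (λ d → f (r , suc (part (γ a) r + d))))
    ⨁-cells a f = ≈-trans (⨁-concatMap (λ r → map (λ c → (r , c)) (range (part (γ a) r) (part (β a) r))) (rows a) f)
      (⨁-cong (rows a) λ {r} _ → ≈-reflexive (trans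
        (⨁-map (λ c → (r , c)) (range (part (γ a) r) (part (β a) r)) f)
        (⨁-map (λ d → suc (part (γ a) r + d)) (upTo (size a r)) (λ c → f (r , c)))))

    ⨁-allCells : ∀ (f : Fin k × ℕ × ℕ → Carrier) →
      ⨁ allCells f ≈ ⨁ (allFin k) (λ a → ⨁ (rows a) (λ r → ⨁ (upTo (size a r)) (λ d → f (a , r , suc (part (γ a) r + d)))))
    ⨁-allCells f = ≈-trans (⨁-concatMap (λ a → map (λ rc → (a , rc)) (cells a)) (allFin k) f)
      (⨁-cong (allFin k) λ {a} _ → ≈-trans (≈-reflexive (⨁-map (λ rc → (a , rc)) (cells a) f)) (⨁-cells a (λ rc → f (a , rc))))

  triplesAbove : Filling → Fin k → ℕ → ℕ → ℕ
  triplesAbove F a v i = above (λ b → triples F b v i) a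

  coinv-cells : ∀ F → InRange F → coinv F ≡ ∑ allCells (λ { (a , r , c) → triplesAbove F a (F a r c) (G a r + (c ∸ suc (part (γ a) r))) })
  coinv-cells F inR = trans (∑-cong (allFin k) λ {a} _ → color a) (sym (⨁-byColor _))
    where
    open ≡-Reasoning
    ⨁-byColor : ∀ (f : Fin k × ℕ × ℕ → ℕ) → ∑ allCells f ≡ ∑ (allFin k) (λ a → ∑ (cells a) (λ rc → f (a , rc)))
    ⨁-byColor f = trans (∑-concatMap (λ a → map (λ rc → (a , rc)) (cells a)) (allFin k) f)
      (∑-cong (allFin k) λ {a} _ → ∑-map (λ rc → (a , rc)) (cells a) f)
    cellTriples : Fin k → Fin k → ℕ × ℕ → ℕ
    cellTriples a b (r , c) = triples F b (F a r c) (G a r + (c ∸ suc (part (γ a) r)))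
    inner : ∀ a b {r c} → (r , c) ∈ cells a →
      sumℕ (map (λ r′ → countL (λ c′ → ⌊ content r′ c′ ℤ.≟ content r c ⌋ ∧ coinvCond F a r c b r′ c′) (wCols b r′)) (rows b))
        ≡ cellTriples a b (r , c)
    inner a b {r} m with ∈-cells⁻ a m
    ... | (1≤r , r≤p) , d , d< , refl with inR (∈-allCells a r d 1≤r r≤p d<)
    ...   | 1≤v , v≤n = trans (∑-cong (rows b) λ {r′} r′∈ →
        triple-count F a r d b r′ 1≤r r≤p (proj₁ (∈-rows⁻ r′∈)) (proj₂ (∈-rows⁻ r′∈)) 1≤v v≤n)
      (cong (λ m → triples F b (F a r (suc (part (γ a) r + d))) (G a r + m)) (sym (m+n∸m≡n (part (γ a) r) d)))
    color : ∀ a → sumℕ (map (λ b →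
      if ⌊ a Fin.<? b ⌋ then
        sumℕ (map (λ { (r , c) → sumℕ (map (λ r′ →
          countL (λ c′ → ⌊ content r′ c′ ℤ.≟ content r c ⌋ ∧ coinvCond F a r c b r′ c′) (wCols b r′)) (rows b)) }) (cells a))
      else 0) (allFin k))
      ≡ ∑ (cells a) (λ { (r , c) → triplesAbove F a (F a r c) (G a r + (c ∸ suc (part (γ a) r))) })
    color a = begin
      _ ≡⟨ ∑-cong (allFin k) (λ {b} _ → cong₂ (λ l m → if l then m else 0) (isYes≗does (a Fin.<? b))
             (∑-cong (cells a) λ { {r , c} m → inner a b m })) ⟩
      ∑ (allFin k) (λ b → if toℕ a <ᵇ toℕ b then ∑ (cells a) (cellTriples a b) else 0)
        ≡⟨ ∑-cong (allFin k) (λ {b} _ → ∑-if (cells a) (toℕ a <ᵇ toℕ b)) ⟨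
      ∑ (allFin k) (λ b → ∑ (cells a) (λ rc → if toℕ a <ᵇ toℕ b then cellTriples a b rc else 0))
        ≡⟨ ∑-swap (allFin k) (cells a) _ ⟩
      ∑ (cells a) (λ rc → ∑ (allFin k) (λ b → if toℕ a <ᵇ toℕ b then cellTriples a b rc else 0))
        ≡⟨ ∑-cong (cells a) (λ { {r , c} m → refl }) ⟩
      ∑ (cells a) _ ∎

<-monotone-decreasing : ∀ (g : ℕ → ℕ) p → (∀ r → 1 ≤ r → suc r ≤ p → g (suc r) < g r) →
  ∀ {r r′} → 1 ≤ r → r < r′ → r′ ≤ p → g r′ < g r
<-monotone-decreasing g p dec 1≤r lt le = go 1≤r (≤⇒≤′ lt) le
  where
  go : ∀ {r r′} → 1 ≤ r → suc r ≤′ r′ → r′ ≤ p → g r′ < g r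
  go 1≤r ≤′-refl      le = dec _ 1≤r le
  go 1≤r (≤′-step lt) le = <-trans (dec _ (≤-trans 1≤r (<⇒≤ (≤′⇒≤ lt))) le) (go 1≤r lt (<⇒≤ le))

module Bijection {k : ℕ} {β γ : Fin k → List ℕ} (C : Coordinates β γ) (n : ℕ) (1≤n : 1 ≤ n) where
  open Coordinates C
  open Shape β γ
  open Tableau C n
  open Triples C n

  particleRow : (Fin k → ℕ → ℕ) → List (Vec Bool k)
  particleRow g = applyUpTo (λ i → tabulate (λ a → anyL (λ r → i ≡ᵇ g a r) (rows a))) W

  suffix-particleRow : ∀ (g : Fin k → ℕ → ℕ) → (∀ a r → 1 ≤ r → suc r ≤ p a → g a (suc r) < g a r) →
    (∀ a r → 1 ≤ r → r ≤ p a → g a r < W) → ∀ a j → suffix a (particleRow g) j ≡ cnt (λ r → j ≤ᵇ g a r) (p a)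
  suffix-particleRow g dec bound a = suffix-applyUpTo a _ W (λ j → cnt (λ r → j ≤ᵇ g a r) (p a)) step
    (λ j W≤j → cnt-none _ (p a) λ r 1≤r r≤p → ≤ᵇ-false (<-≤-trans (bound a r 1≤r r≤p) W≤j))
    where
    open ≡-Reasoning
    at : ℕ → ℕ → Bool
    at i r = i ≡ᵇ g a r
    pointwise : ∀ i m → b2n (i ≤ᵇ m) ≡ b2n (i ≡ᵇ m) + b2n (suc i ≤ᵇ m)
    pointwise i m with <-cmp i m
    ... | tri< i<m i≢m _ rewrite ≤ᵇ-true (<⇒≤ i<m) | <ᵇ-true i<m | ¬T⇒≡false {i ≡ᵇ m} (λ t → i≢m (≡ᵇ⇒≡ i m t)) = refl
    ... | tri≈ _ refl _ rewrite ≤ᵇ-true (≤-refl {i}) | <ᵇ-false (≤-refl {i}) | T⇒≡true (≡⇒≡ᵇ i i refl) = refl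
    ... | tri> _ i≢m m<i rewrite ≤ᵇ-false m<i | <ᵇ-false (<⇒≤ m<i) | ¬T⇒≡false {i ≡ᵇ m} (λ t → i≢m (≡ᵇ⇒≡ i m t)) = refl
    g-injective : ∀ i {r r′} → r ∈ rows a → r′ ∈ rows a → T (at i r) → T (at i r′) → r ≡ r′
    g-injective i {r} {r′} r∈ r′∈ t t′ with <-cmp r r′ | trans (sym (≡ᵇ⇒≡ i _ t)) (≡ᵇ⇒≡ i _ t′)
    ... | tri< lt _ _ | eq = ⊥-elim (<-irrefl (sym eq) (<-monotone-decreasing (g a) (p a) (dec a) (proj₁ (∈-rows⁻ r∈)) lt (proj₂ (∈-rows⁻ r′∈))))
    ... | tri≈ _ eq _ | _ = eq
    ... | tri> _ _ gt | eq = ⊥-elim (<-irrefl eq (<-monotone-decreasing (g a) (p a) (dec a) (proj₁ (∈-rows⁻ r′∈)) gt (proj₂ (∈-rows⁻ r∈))))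
    step : ∀ i → cnt (λ r → i ≤ᵇ g a r) (p a)
      ≡ b2n (lookup (tabulate (λ a → anyL (λ r → i ≡ᵇ g a r) (rows a))) a) + cnt (λ r → suc i ≤ᵇ g a r) (p a)
    step i = begin
      cnt (λ r → i ≤ᵇ g a r) (p a)                           ≡⟨ ∑-cong (rows a) (λ {r} _ → pointwise i (g a r)) ⟩
      ∑ (rows a) (λ r → b2n (at i r) + b2n (suc i ≤ᵇ g a r)) ≡⟨ ∑-+ (rows a) (b2n ∘ at i) (λ r → b2n (suc i ≤ᵇ g a r)) ⟩
      ∑ (rows a) (b2n ∘ at i) + _                            ≡⟨ cong (_+ cnt (λ r → suc i ≤ᵇ g a r) (p a))
        (trans (sym (anyL≡∑ (at i) (rows-unique (p a)) (g-injective i)))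
               (cong b2n (sym (lookup∘tabulate (λ a → anyL (λ r → i ≡ᵇ g a r) (rows a)) a)))) ⟩
      _                                                      ∎

  bottom top : List (Vec Bool k)
  bottom = particleRow G
  top = particleRow B

  suffix-bottom : ∀ a j → suffix a bottom j ≡ heightγ a j
  suffix-bottom = suffix-particleRow G G-decreasing (λ a r 1≤r r≤p → ≤-<-trans (G≤B a r 1≤r r≤p) (B<W a r 1≤r r≤p))

  suffix-top : ∀ a j → suffix a top j ≡ heightβ a j
  suffix-top = suffix-particleRow B B-decreasing B<W

  rowOf : (Fin k → ℕ → ℕ → ℕ) → ℕ → List (Vec Bool k)
  rowOf H e = applyUpTo (λ i → tabulate (λ a → H a e (suc i) <ᵇ H a e i)) W

  module _ {H : Fin k → ℕ → ℕ → ℕ} (hs : Heights H) where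
    open Heights hs

    heights-square : ∀ {e} → e < n → ∀ a j → Square (H a e (suc j)) (H a e j) (H a (suc e) (suc j)) (H a (suc e) j)
    heights-square {e} e<n a j = square (antitone a e j) (grow a e (suc j) e<n) (grow a e j e<n) (antitone a (suc e) j) (growth≤1 a e j e<n)

    heights-step : ∀ {e} → e ≤ n → ∀ a j → H a e j ≡ b2n (H a e (suc j) <ᵇ H a e j) + H a e (suc j)
    heights-step {zero}  e≤n a j = square-left (heights-square 1≤n a j)
    heights-step {suc e} e<n a j = square-right (heights-square e<n a j)

    heights-right : ∀ {e} → e ≤ n → ∀ a j → W ≤ j → H a e j ≡ 0
    heights-right {e} e≤n a j W≤j = n≤0⇒n≡0 (subst (H a e j ≤_) (trans (final a j)
      (cnt-none _ (p a) λ r 1≤r r≤p → ≤ᵇ-false (<-≤-trans (B<W a r 1≤r r≤p) W≤j))) (heights-mono hs a j e≤n ≤-refl))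

    heights-left : ∀ {e} → e ≤ n → ∀ a → H a e 0 ≡ p a
    heights-left {e} e≤n a = ≤-antisym
      (≤-trans (heights-mono hs a 0 e≤n ≤-refl) (subst (_≤ p a) (sym (final a 0)) (cnt≤ _ (p a))))
      (subst (_≤ H a e 0) (trans (initial a 0) (cnt-all _ (p a) (λ _ _ _ → tt))) (heights-mono hs a 0 z≤n e≤n))

    suffix-rowOf : ∀ {e} → e ≤ n → ∀ a j → suffix a (rowOf H e) j ≡ H a e j
    suffix-rowOf {e} e≤n a = suffix-applyUpTo a _ W (H a e)
      (λ i → trans (heights-step e≤n a i) (cong (λ b → b2n b + H a e (suc i)) (sym (lookup∘tabulate _ a))))
      (heights-right e≤n a)

    bottom≡rowOf : bottom ≡ rowOf H 0
    bottom≡rowOf = suffix-injective (trans (length-applyUpTo _ W) (sym (length-applyUpTo _ W)))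
      λ a j → trans (suffix-bottom a j) (trans (sym (initial a j)) (sym (suffix-rowOf z≤n a j)))

    top≡rowOf : top ≡ rowOf H n
    top≡rowOf = suffix-injective (trans (length-applyUpTo _ W) (sym (length-applyUpTo _ W)))
      λ a j → trans (suffix-top a j) (trans (sym (final a j)) (sym (suffix-rowOf ≤-refl a j)))

  confOf : Filling → List (List (Vec Bool k))
  confOf F = applyUpTo (rowOf (height F) ∘ suc) n

  confOf-length : ∀ F {m} → m ∈ confOf F → length m ≡ W
  confOf-length F m∈ with ∈-applyUpTo⁻ (rowOf (height F) ∘ suc) m∈
  ... | _ , _ , refl = length-applyUpTo _ W

  confHeights : List (List (Vec Bool k)) → Fin k → ℕ → ℕ → ℕ
  confHeights ms a e j = suffix a (nth (bottom ∷ ms) e) j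

  confHeights-heights : ∀ ms → (∀ e → e < n → Interlaced (nth (bottom ∷ ms) e) (nth (bottom ∷ ms) (suc e))) →
    nth (bottom ∷ ms) n ≡ top → Heights (confHeights ms)
  confHeights-heights ms il end = record
    { initial = suffix-bottom
    ; final = λ a j → trans (cong (λ r → suffix a r j) end) (suffix-top a j)
    ; antitone = λ a e j → suffix-antitone a (nth (bottom ∷ ms) e) j
    ; grow = λ a e j e<n → proj₁ (il e e<n a j)
    ; growth≤1 = λ a e j e<n → proj₂ (il e e<n a j)
    }

  confOf-tableau : ∀ {ms F} → length ms ≡ n → (∀ {m} → m ∈ ms → length m ≡ W) → Heights (confHeights ms) →
    Agree F (tableau (confHeights ms)) → confOf F ≡ ms
  confOf-tableau {ms} {F} len lens hs agree = nth-ext (trans (length-applyUpTo _ n) (sym len)) λ e e<len →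
    let e<n = subst (e <_) (length-applyUpTo _ n) e<len in
    trans (nth-applyUpTo _ n e e<n) (suffix-injective
      (trans (length-applyUpTo _ W) (sym (lens (nth-∈ ms e (subst (e <_) (sym len) e<n)))))
      λ a j → trans (suffix-rowOf (FromFilling.heights ss 1≤n) e<n a j) (FromHeights.height≡H hs {F} agree a (suc e) j 1≤n e<n))
    where
    ss : Semistandard F
    ss = FromHeights.tableau-semistandard hs agree

  agree-confOf : ∀ {F} → Semistandard F → Agree F (tableau (confHeights (confOf F)))
  agree-confOf {F} ss = filling≡tableau ss 1≤n eq
    where
    hs = FromFilling.heights ss 1≤n
    eq : ∀ a e j → e ≤ n → confHeights (confOf F) a e j ≡ height F a e j
    eq a zero    j _   = trans (suffix-bottom a j) (sym (Heights.initial hs a j))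
    eq a (suc e) j e<n = trans (cong (λ r → suffix a r j) (nth-applyUpTo (rowOf (height F) ∘ suc) n e e<n)) (suffix-rowOf hs e<n a j)

module Evaluation {c ℓ : Level} (R : CommutativeSemiring c ℓ) {k n : ℕ} {β γ : Fin k → List ℕ}
  (C : Coordinates β γ) (1≤n : 1 ≤ n) (x : Fin n → CommutativeSemiring.Carrier R) (t : CommutativeSemiring.Carrier R) where
  open CommutativeSemiring R using (Carrier; _≈_; 0#; 1#; setoid)
    renaming ( *-commutativeMonoid to ⊛-commutativeMonoid; _+_ to _⊕_; _*_ to _⊛_; refl to ≈-refl; sym to ≈-sym; trans to ≈-trans
             ; reflexive to ≈-reflexive; *-congˡ to ⊛-congˡ; *-congʳ to ⊛-congʳ)
  open Weights R
  open Weights.LLT R {k} {n} β γ x t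
  open Lattice R
  open Coordinates C
  open Shape β γ
  open Tableau C n
  open Triples C n
  open Conf C n
  open Bijection C n 1≤n
  open Cells ⊛-commutativeMonoid renaming (⨁-allCells to Π-allCells) using ()
  open import Relation.Binary.Reasoning.Setoid setoid

  cellWeight : Filling → Fin k → ℕ → ℕ → Carrier
  cellWeight F a v i = xAt x v ⊛ pow t (triplesAbove F a v i)

  cellsWeight : Filling → Carrier
  cellsWeight F = Π′ (allFin k) λ a → Π′ (rows a) λ r → Π′ (upTo (size a r)) λ d →
    cellWeight F a (F a r (suc (part (γ a) r + d))) (G a r + d)

  tableau-cellsWeight : ∀ F → InRange F → pow t (coinv F) ⊛ monomial F ≈ cellsWeight F
  tableau-cellsWeight F inR = begin
    pow t (coinv F) ⊛ monomial F
      ≈⟨ ⊛-congʳ (≈-trans (≈-reflexive (cong (pow t) (coinv-cells F inR))) (pow-∑ t allCells _)) ⟩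
    Π′ allCells _ ⊛ monomial F
      ≈⟨ CommutativeSemiring.*-comm R _ _ ⟩
    monomial F ⊛ Π′ allCells _
      ≈⟨ Π-⊛ allCells _ _ ⟨
    Π′ allCells _
      ≈⟨ Π-allCells _ ⟩
    Π′ (allFin k) (λ a → Π′ (rows a) λ r → Π′ (upTo (size a r)) λ d →
      cellWeight F a (F a r (suc (part (γ a) r + d))) (G a r + (part (γ a) r + d ∸ part (γ a) r)))
      ≈⟨ Π-cong (allFin k) (λ {a} _ → Π-cong (rows a) λ {r} _ → Π-cong (upTo (size a r)) λ {d} _ →
           ≈-reflexive (cong (λ m → cellWeight F a (F a r (suc (part (γ a) r + d))) (G a r + m)) (m+n∸m≡n (part (γ a) r) d))) ⟩
    cellsWeight F ∎

  Π-select : ∀ m (f : ℕ → Carrier) →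
    Π′ (upTo n) (λ e → if m ≡ᵇ suc e then f (suc e) else 1#) ≈ (if (0 <ᵇ m) ∧ (m ≤ᵇ n) then f m else 1#)
  Π-select zero    f = Π-one (upTo n) (λ _ → ≈-refl)
  Π-select (suc m) f with suc m ≤? n
  ... | yes m<n rewrite <ᵇ-true m<n = ≈-trans
    (Π-single (Unique.upTo⁺ n) (∈-upTo⁺ m<n) λ {e} _ e≢m → ≈-reflexive
      (cong (λ b → if b then f (suc e) else 1#) (¬T⇒≡false (λ s → e≢m (sym (≡ᵇ⇒≡ m e s))))))
    (≈-reflexive (cong (λ b → if b then f (suc m) else 1#) (T⇒≡true (≡⇒≡ᵇ m m refl))))
  ... | no m≮n rewrite <ᵇ-false (≮⇒≥ m≮n) = Π-one (upTo n) λ {e} e∈ → ≈-reflexive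
    (cong (λ b → if b then f (suc e) else 1#) (¬T⇒≡false (λ s → m≮n (subst (λ z → suc z ≤ n) (sym (≡ᵇ⇒≡ m e s)) (∈-upTo⁻ e∈)))))

  module _ {F : Filling} (ss : Semistandard F) where
    open Semistandard ss
    hs : Heights (height F)
    hs = FromFilling.heights ss 1≤n

    rightEdge leftEdge bottomEdge : ℕ → ℕ → Fin k → Bool
    rightEdge e i a = height F a e (suc i) <ᵇ height F a (suc e) (suc i)
    leftEdge e i a = height F a e i <ᵇ height F a (suc e) i
    bottomEdge e i a = height F a e (suc i) <ᵇ height F a e i

    entry-split : ∀ m e → b2n (m ≤ᵇ suc e) ≡ b2n (m ≡ᵇ suc e) + b2n (m ≤ᵇ e)
    entry-split m e with <-cmp m (suc e)
    ... | tri< lt neq _ rewrite ≤ᵇ-true (<⇒≤ lt) | ≤ᵇ-true (s≤s⁻¹ lt) | ¬T⇒≡false {m ≡ᵇ suc e} (λ s → neq (≡ᵇ⇒≡ m _ s)) = refl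
    ... | tri≈ _ refl _ rewrite T⇒≡true (≡⇒≡ᵇ e e refl) | <ᵇ-true (n<1+n e) | <ᵇ-false (≤-refl {e}) = refl
    ... | tri> _ neq gt rewrite ≤ᵇ-false gt | ≤ᵇ-false (<⇒≤ gt) | ¬T⇒≡false {m ≡ᵇ suc e} (λ s → neq (≡ᵇ⇒≡ m _ s)) = refl

    rightEdge-count : ∀ e → e < n → ∀ i a → b2n (rightEdge e i a) ≡ cnt (λ r → τ F a r (suc i) ≡ᵇ suc e) (p a)
    rightEdge-count e e<n i a = +-cancelʳ-≡ (height F a e (suc i)) _ _ (trans (sym (square-top (heights-square hs e<n a i)))
      (trans (∑-cong (rows a) (λ {r} _ → entry-split (τ F a r (suc i)) e))
             (∑-+ (rows a) (λ r → b2n (τ F a r (suc i) ≡ᵇ suc e)) (λ r → b2n (τ F a r (suc i) ≤ᵇ e)))))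

    incoming-count : ∀ e → e < n → ∀ i b → b2n (bottomEdge e i b) + b2n (leftEdge e i b) ≡ triples F b (suc e) i
    incoming-count e e<n i b = +-cancelʳ-≡ (height F b e (suc i)) _ _ (trans (sym (square-in (heights-square hs e<n b i)))
      (trans (∑-cong (rows b) (λ {r} r∈ → split r (proj₁ (∈-rows⁻ r∈)) (proj₂ (∈-rows⁻ r∈))))
             (∑-+ (rows b) (b2n ∘ isTriple F b (suc e) i) (λ r → b2n (τ F b r (suc i) ≤ᵇ e)))))
      where
      split : ∀ r → 1 ≤ r → r ≤ p b → b2n (τ F b r i ≤ᵇ suc e) ≡ b2n (isTriple F b (suc e) i r) + b2n (τ F b r (suc i) ≤ᵇ e)
      split r 1≤r r≤p = go (τ F b r i) (τ F b r (suc i)) (weak b r i 1≤r r≤p)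
        where
        go : ∀ u w → u ≤ w → b2n (u ≤ᵇ suc e) ≡ b2n ((u ≤ᵇ suc e) ∧ (suc e ≤ᵇ w)) + b2n (w ≤ᵇ e)
        go u w u≤w with w ≤? e
        ... | yes w≤e rewrite ≤ᵇ-true w≤e | <ᵇ-false w≤e | ≤ᵇ-true (m≤n⇒m≤1+n (≤-trans u≤w w≤e)) = refl
        ... | no w≰e rewrite ≤ᵇ-false (≰⇒> w≰e) | <ᵇ-true (≰⇒> w≰e) with u ≤ᵇ suc e
        ...   | true  = refl
        ...   | false = refl

    face-entries : ∀ e → e < n → ∀ i a →
      (if rightEdge e i a then colorWeight (xAt x (suc e)) t (bottomEdge e i) (leftEdge e i) a else 1#)
        ≈ Π′ (rows a) (λ r → if τ F a r (suc i) ≡ᵇ suc e then cellWeight F a (suc e) i else 1#)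
    face-entries e e<n i a = begin
      (if rightEdge e i a then colorWeight (xAt x (suc e)) t (bottomEdge e i) (leftEdge e i) a else 1#)
        ≡⟨ cong (λ m → if rightEdge e i a then xAt x (suc e) ⊛ pow t m else 1#)
             (∑-cong (allFin k) (λ {b} _ → cong (λ m → if toℕ a <ᵇ toℕ b then m else 0) (incoming-count e e<n i b))) ⟩
      (if rightEdge e i a then w else 1#)
        ≈⟨ pow-b2n w (rightEdge e i a) ⟨
      pow w (b2n (rightEdge e i a))
        ≡⟨ cong (pow w) (rightEdge-count e e<n i a) ⟩
      pow w (cnt (λ r → τ F a r (suc i) ≡ᵇ suc e) (p a))
        ≈⟨ pow-∑ w (rows a) _ ⟩
      Π′ (rows a) (λ r → pow w (b2n (τ F a r (suc i) ≡ᵇ suc e)))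
        ≈⟨ Π-cong (rows a) (λ {r} _ → pow-b2n w (τ F a r (suc i) ≡ᵇ suc e)) ⟩
      Π′ (rows a) (λ r → if τ F a r (suc i) ≡ᵇ suc e then w else 1#) ∎
      where w = cellWeight F a (suc e) i

    row-entries : ∀ e → e < n → rowWeight (xAt x (suc e)) t (zeroV k) (rowOf (height F) e) (rowOf (height F) (suc e))
      ≈ Π′ (upTo W) λ i → Π′ (allFin k) λ a → Π′ (rows a) λ r → if τ F a r (suc i) ≡ᵇ suc e then cellWeight F a (suc e) i else 1#
    row-entries e e<n = begin
      rowWeight X t (zeroV k) (rowOf (height F) e) (rowOf (height F) (suc e))
        ≡⟨ cong (λ J → rowWeight X t J (rowOf (height F) e) (rowOf (height F) (suc e)))
             (sym (vanishing 0 λ a → trans (heights-left hs (<⇒≤ e<n) a) (sym (heights-left hs e<n a)))) ⟩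
      rowWeight X t (tabulate (leftEdge e 0)) (rowOf (height F) e) (rowOf (height F) (suc e))
        ≈⟨ rowWeight-applyUpTo X t (tabulate ∘ bottomEdge e) (tabulate ∘ leftEdge e) _ W
             (λ i → okFace-tabulate (bottomEdge e i) (leftEdge e i) (λ a → height F a (suc e) (suc i) <ᵇ height F a (suc e) i) (rightEdge e i)
               (λ a → square-conserve (heights-square hs e<n a i)) (λ a → square-exclusive (heights-square hs e<n a i)))
             (vanishing W λ a → trans (heights-right hs (<⇒≤ e<n) a W ≤-refl) (sym (heights-right hs e<n a W ≤-refl))) ⟩
      Π′ (upTo W) (λ i → faceMonomial X t (tabulate (bottomEdge e i)) (tabulate (leftEdge e i)) (tabulate (rightEdge e i)))
        ≈⟨ Π-cong (upTo W) (λ {i} _ → ≈-trans (faceMonomial-colors X t (bottomEdge e i) (leftEdge e i) (rightEdge e i))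
             (Π-cong (allFin k) λ {a} _ → face-entries e e<n i a)) ⟩
      _ ∎
      where
      X = xAt x (suc e)
      vanishing : ∀ j → (∀ a → height F a e j ≡ height F a (suc e) j) → tabulate (leftEdge e j) ≡ zeroV k
      vanishing j eq = vec-ext λ a → trans (lookup∘tabulate (leftEdge e j) a)
        (trans (<ᵇ-false (≤-reflexive (sym (eq a)))) (sym (lookup-replicate a false)))

    row-cells : ∀ a r → 1 ≤ r → r ≤ p a →
      Π′ (upTo W) (λ i → Π′ (upTo n) λ e → if τ F a r (suc i) ≡ᵇ suc e then cellWeight F a (suc e) i else 1#)
        ≈ Π′ (upTo (size a r)) (λ d → cellWeight F a (F a r (suc (part (γ a) r + d))) (G a r + d))
    row-cells a r 1≤r r≤p = begin
      _ ≈⟨ Π-cong (upTo W) (λ {i} _ → ≈-trans (Π-select (τ F a r (suc i)) (λ v → cellWeight F a v i))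
             (≈-reflexive (cong (λ b → if b then cellWeight F a (τ F a r (suc i)) i else 1#) (occupied (suc i))))) ⟩
      Π′ (upTo W) (λ i → if (G a r <ᵇ suc i) ∧ (suc i ≤ᵇ B a r) then Φ (suc i) else 1#)
        ≈⟨ Π-interval W (G a r) (B a r) Φ (<⇒≤ (B<W a r 1≤r r≤p)) ⟩
      Π′ (upTo (B a r ∸ G a r)) (λ d → Φ (G a r + suc d))
        ≡⟨ cong (λ m → Π′ (upTo m) (λ d → Φ (G a r + suc d))) (B∸G≡size a r 1≤r r≤p) ⟩
      Π′ (upTo (size a r)) (λ d → Φ (G a r + suc d))
        ≈⟨ Π-cong (upTo (size a r)) (λ {d} d∈ → ≈-reflexive (cong₂ (cellWeight F a)
             (τ-cell F 1≤r r≤p (∈-upTo⁻ d∈)) (cong pred (+-suc (G a r) d)))) ⟩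
      _ ∎
      where
      Φ : ℕ → Carrier
      Φ j = cellWeight F a (τ F a r j) (pred j)
      occupied : ∀ j → (0 <ᵇ τ F a r j) ∧ (τ F a r j ≤ᵇ n) ≡ (G a r <ᵇ j) ∧ (j ≤ᵇ B a r)
      occupied j with locate a r 1≤r r≤p j
      ... | low le rewrite τ-low F le | <ᵇ-false le = refl
      ... | high lt rewrite τ-high F 1≤r r≤p lt | <ᵇ-false (≤-refl {n}) | ≤ᵇ-false lt with G a r <ᵇ j
      ...   | true  = refl
      ...   | false = refl
      occupied j | cell d refl d<
        rewrite τ-cell F 1≤r r≤p d< | <ᵇ-true (≥1 a r d 1≤r r≤p d<) | ≤ᵇ-true (≤n a r d 1≤r r≤p d<)
              | <ᵇ-true (G+<-low a r d)
              | ≤ᵇ-true (subst (G a r + suc d ≤_) (sym (B≡G+size a r 1≤r r≤p)) (+-monoʳ-≤ (G a r) d<)) = refl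

    chain-cellsWeight : chainWeight t (applyUpTo (λ e → xAt x (suc e)) n) bottom top (confOf F) ≈ cellsWeight F
    chain-cellsWeight = begin
      chainWeight t xs bottom top (confOf F)
        ≡⟨ cong₂ (λ b u → chainWeight t xs b u (confOf F)) (bottom≡rowOf hs) (top≡rowOf hs) ⟩
      chainWeight t xs (row 0) (row n) (confOf F)
        ≈⟨ chainWeight-applyUpTo t (λ e → xAt x (suc e)) row n ⟩
      Π′ (upTo n) (λ e → rowWeight (xAt x (suc e)) t (zeroV k) (row e) (row (suc e)))
        ≈⟨ Π-cong (upTo n) (λ {e} e∈ → row-entries e (∈-upTo⁻ e∈)) ⟩
      Π′ (upTo n) (λ e → Π′ (upTo W) λ i → Π′ (allFin k) λ a → Π′ (rows a) λ r → f e i a r)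
        ≈⟨ Π-cong (upTo n) (λ {e} _ → Π-swap (upTo W) (allFin k) (λ i a → Π′ (rows a) (f e i a))) ⟩
      Π′ (upTo n) (λ e → Π′ (allFin k) λ a → Π′ (upTo W) λ i → Π′ (rows a) λ r → f e i a r)
        ≈⟨ Π-swap (upTo n) (allFin k) (λ e a → Π′ (upTo W) λ i → Π′ (rows a) (f e i a)) ⟩
      Π′ (allFin k) (λ a → Π′ (upTo n) λ e → Π′ (upTo W) λ i → Π′ (rows a) λ r → f e i a r)
        ≈⟨ Π-cong (allFin k) (λ {a} _ → color a) ⟩
      cellsWeight F ∎
      where
      xs = applyUpTo (λ e → xAt x (suc e)) n
      row = rowOf (height F)
      f : ℕ → ℕ → Fin k → ℕ → Carrier
      f e i a r = if τ F a r (suc i) ≡ᵇ suc e then cellWeight F a (suc e) i else 1#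
      color : ∀ a → Π′ (upTo n) (λ e → Π′ (upTo W) λ i → Π′ (rows a) λ r → f e i a r) ≈
        Π′ (rows a) λ r → Π′ (upTo (size a r)) λ d → cellWeight F a (F a r (suc (part (γ a) r + d))) (G a r + d)
      color a = begin
        Π′ (upTo n) (λ e → Π′ (upTo W) λ i → Π′ (rows a) λ r → f e i a r)
          ≈⟨ Π-cong (upTo n) (λ {e} _ → Π-swap (upTo W) (rows a) (λ i r → f e i a r)) ⟩
        Π′ (upTo n) (λ e → Π′ (rows a) λ r → Π′ (upTo W) λ i → f e i a r)
          ≈⟨ Π-swap (upTo n) (rows a) (λ e r → Π′ (upTo W) λ i → f e i a r) ⟩
        Π′ (rows a) (λ r → Π′ (upTo n) λ e → Π′ (upTo W) λ i → f e i a r)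
          ≈⟨ Π-cong (rows a) (λ {r} r∈ → ≈-trans (Π-swap (upTo n) (upTo W) (λ e i → f e i a r))
               (row-cells a r (proj₁ (∈-rows⁻ r∈)) (proj₂ (∈-rows⁻ r∈)))) ⟩
        _ ∎

module Fillings {k : ℕ} (β γ : Fin k → List ℕ) (n : ℕ) where
  open Shape β γ

  Site : Set
  Site = Fin k × ℕ × ℕ

  at : Filling → Site → ℕ
  at F (a , r , c) = F a r c

  fillings : List Site → Filling → List Filling
  fillings []       F = F ∷ []
  fillings (u ∷ us) F = concatMap (λ v → fillings us (update F u v)) (range 0 n)

  update-same : ∀ F u v → at (update F u v) u ≡ v
  update-same F (a , r , c) v rewrite trans (isYes≗does (a Fin.≟ a)) (dec-true (a Fin.≟ a) refl)
    | T⇒≡true (≡⇒≡ᵇ r r refl) | T⇒≡true (≡⇒≡ᵇ c c refl) = refl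

  update-cases : ∀ F u v u′ → (u′ ≡ u × at (update F u v) u′ ≡ v) ⊎ at (update F u v) u′ ≡ at F u′
  update-cases F (a , r , c) v (a′ , r′ , c′) with a′ Fin.≟ a | r′ ≡ᵇ r in eqr | c′ ≡ᵇ c in eqc
  ... | no _     | _     | _     = inj₂ refl
  ... | yes _    | false | _     = inj₂ refl
  ... | yes _    | true  | false = inj₂ refl
  ... | yes refl | true  | true
    rewrite ≡ᵇ⇒≡ r′ r (subst T (sym eqr) tt) | ≡ᵇ⇒≡ c′ c (subst T (sym eqc) tt) = inj₁ (refl , refl)

  Within : ℕ → Set
  Within v = 1 ≤ v × v ≤ n

  ∈-range-within : ∀ {v} → v ∈ range 0 n → Within v
  ∈-range-within v∈ with ∈-range⁻ {0} {n} v∈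
  ... | d , d<n , refl = s≤s z≤n , d<n

  fillings-within : ∀ us {F F′} → F′ ∈ fillings us F → ∀ u → u ∈ us ⊎ Within (at F u) → Within (at F′ u)
  fillings-within []       (here refl) u (inj₂ w) = w
  fillings-within (w ∷ us) {F} F′∈ u cond with ∈-concatMap⁻ (λ v → fillings us (update F w v)) (range 0 n) F′∈
  ... | v , v∈ , F′∈′ = fillings-within us F′∈′ u (later cond)
    where
    later : u ∈ w ∷ us ⊎ Within (at F u) → u ∈ us ⊎ Within (at (update F w v) u)
    later (inj₁ (there u∈))  = inj₁ u∈
    later (inj₁ (here refl)) = inj₂ (subst Within (sym (update-same F w v)) (∈-range-within v∈))
    later (inj₂ wi) with update-cases F w v u
    ... | inj₁ (_ , eq) = inj₂ (subst Within (sym eq) (∈-range-within v∈))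
    ... | inj₂ eq       = inj₂ (subst Within (sym eq) wi)

  fillings-outside : ∀ us {F F′} → F′ ∈ fillings us F → ∀ u → u ∉ us → at F′ u ≡ at F u
  fillings-outside []       (here refl) u _ = refl
  fillings-outside (w ∷ us) {F} F′∈ u u∉ with ∈-concatMap⁻ (λ v → fillings us (update F w v)) (range 0 n) F′∈
  ... | v , v∈ , F′∈′ with update-cases F w v u
  ...   | inj₁ (eq , _) = ⊥-elim (u∉ (here eq))
  ...   | inj₂ eq       = trans (fillings-outside us F′∈′ u (u∉ ∘ there)) eq

  module _ {c ℓ : Level} (M : CommutativeMonoid c ℓ) where
    open CommutativeMonoid M using (Carrier; _≈_; ε) renaming (trans to ≈-trans; identityʳ to ∙-identityʳ)
    open BigOp M

    ⨁-fillings-single : ∀ us F {f : Filling → Carrier} {y} (F₀ : Filling) → Unique us → (∀ {u} → u ∈ us → Within (at F₀ u)) →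
      (∀ {F′} → F′ ∈ fillings us F → ∀ {u} → u ∈ us → at F′ u ≢ at F₀ u → f F′ ≈ ε) →
      (∀ {F′} → F′ ∈ fillings us F → (∀ {u} → u ∈ us → at F′ u ≡ at F₀ u) → f F′ ≈ y) →
      ⨁ (fillings us F) f ≈ y
    ⨁-fillings-single []       F F₀ _ _ _ val = ≈-trans (∙-identityʳ _) (val (here refl) λ ())
    ⨁-fillings-single (w ∷ us) F {f} {y} F₀ (w∉ ∷ uniq) within zero′ val = ≈-trans
      (⨁-concatMap (λ v → fillings us (update F w v)) (range 0 n) f)
      (≈-trans (⨁-single (Unique.map⁺ suc-injective (Unique.upTo⁺ n)) v₀∈ others)
        (⨁-fillings-single us (update F w v₀) F₀ uniq (within ∘ there)
          (λ F′∈ u∈ → zero′ (embed v₀∈ F′∈) (there u∈))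
          (λ F′∈ eq → val (embed v₀∈ F′∈) λ { (here refl) → entry F′∈ ; (there u∈) → eq u∈ })))
      where
      v₀ = at F₀ w
      v₀∈ : v₀ ∈ range 0 n
      v₀∈ with v₀ | within (here refl)
      ... | suc d | _ , d<n = ∈-range⁺ {0} {n} {d} d<n
      embed : ∀ {v F′} → v ∈ range 0 n → F′ ∈ fillings us (update F w v) → F′ ∈ fillings (w ∷ us) F
      embed = ∈-concatMap (λ v → fillings us (update F w v))
      entry : ∀ {v F′} → F′ ∈ fillings us (update F w v) → at F′ w ≡ v
      entry {v} F′∈ = trans (fillings-outside us F′∈ w (λ w∈ → All.lookup w∉ w∈ refl)) (update-same F w v)
      others : ∀ {v} → v ∈ range 0 n → v ≢ v₀ → ⨁ (fillings us (update F w v)) f ≈ ε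
      others v∈ v≢ = ⨁-ε _ λ F′∈ → zero′ (embed v∈ F′∈) (here refl) (λ eq → v≢ (trans (sym (entry F′∈)) eq))

module Equality {c ℓ : Level} (R : CommutativeSemiring c ℓ) {k n : ℕ} {β γ : Fin k → List ℕ}
  (C : Coordinates β γ) (1≤n : 1 ≤ n) (x : Fin n → CommutativeSemiring.Carrier R) (t : CommutativeSemiring.Carrier R) where
  open CommutativeSemiring R using (Carrier; _≈_; 0#; 1#; setoid)
    renaming ( +-commutativeMonoid to ⊕-commutativeMonoid; _+_ to _⊕_; _*_ to _⊛_; refl to ≈-refl; sym to ≈-sym; trans to ≈-trans
             ; reflexive to ≈-reflexive)
  open Weights R
  open Weights.LLT R {k} {n} β γ x t
  open Lattice R
  open Coordinates C
  open Shape β γ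
  open Tableau C n
  open Triples C n
  open Bijection C n 1≤n
  open Fillings β γ n
  open Evaluation R C 1≤n x t using (cellsWeight; tableau-cellsWeight; chain-cellsWeight)
  open import Relation.Binary.Reasoning.Setoid setoid

  sumFill-fillings : ∀ us (f : Filling → Carrier) F → sumFill us f F ≈ Σ′ (fillings us F) f
  sumFill-fillings []       f F = ≈-sym (CommutativeSemiring.+-identityʳ R _)
  sumFill-fillings (u ∷ us) f F = ≈-trans
    (Σ-cong (range 0 n) λ {v} _ → sumFill-fillings us f (update F u v))
    (≈-sym (Σ-concatMap (λ v → fillings us (update F u v)) (range 0 n) f))

  _≟ᶜ_ : (ms ms′ : List (List (Vec Bool k))) → Dec (ms ≡ ms′)
  _≟ᶜ_ = ≡-dec (≡-dec (Vec.≡-dec Bool._≟_))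

  spectral : List Carrier
  spectral = applyUpTo (λ e → xAt x (suc e)) n

  confWeight : List (List (Vec Bool k)) → Carrier
  confWeight = chainWeight t spectral bottom top

  emptyFilling : Filling
  emptyFilling _ _ _ = 0

  all-fillings : List Filling
  all-fillings = fillings allCells emptyFilling

  inRange : ∀ {F} → F ∈ all-fillings → InRange F
  inRange F∈ u∈ = fillings-within allCells F∈ _ (inj₁ u∈)

  tableauWeight-conf : ∀ {F} → F ∈ all-fillings → T (semistandard F) → tableauWeight F ≈ confWeight (confOf F)
  tableauWeight-conf {F} F∈ s = begin
    tableauWeight F                    ≡⟨ cong (λ b → if b then pow t (coinv F) ⊛ monomial F else 0#) (T⇒≡true s) ⟩
    pow t (coinv F) ⊛ monomial F       ≈⟨ tableau-cellsWeight F (inRange F∈) ⟩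
    cellsWeight F                      ≈⟨ chain-cellsWeight (semistandard⇒ F (inRange F∈) s) ⟨
    confWeight (confOf F)              ∎

  agree-cells : ∀ {F F₀} → (∀ {u} → u ∈ allCells → at F u ≡ at F₀ u) → Agree F F₀
  agree-cells eq a r d 1≤r r≤p d< = eq (∈-allCells a r d 1≤r r≤p d<)

  fiber : List (List (Vec Bool k)) → Filling → Carrier
  fiber ms F = if ⌊ confOf F ≟ᶜ ms ⌋ then tableauWeight F else 0#

  fiber-vanishes : ∀ ms {F} → (confOf F ≡ ms → T (semistandard F) → tableauWeight F ≈ 0#) → fiber ms F ≈ 0#
  fiber-vanishes ms {F} h with confOf F ≟ᶜ ms | semistandard F
  ... | no _   | _     = ≈-refl
  ... | yes _  | false = ≈-refl
  ... | yes e  | true  = h e tt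

  fiber-total : ∀ {ms} → ms ∈ chains k W n → Σ′ all-fillings (fiber ms) ≈ confWeight ms
  fiber-total {ms} ms∈ with ∈-chains⁻ W n ms∈
  ... | len , lens with chainWeight-support t spectral bottom top ms (trans len (sym (length-applyUpTo _ n)))
  ...   | inj₁ z = ≈-trans
    (Σ-zero all-fillings λ {F} F∈ → fiber-vanishes ms λ e s → ≈-trans (tableauWeight-conf F∈ s) (≈-trans (≈-reflexive (cong confWeight e)) z))
    (≈-sym z)
  ...   | inj₂ (il , end) = ⨁-fillings-single ⊕-commutativeMonoid allCells emptyFilling F₀ allCells-unique
    within disagree value
    where
    hs : Heights (confHeights ms)
    hs = confHeights-heights ms (λ e e<n → il e (subst (e <_) (sym len) e<n)) (subst (λ m → nth (bottom ∷ ms) m ≡ top) len end)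
    F₀ = tableau (confHeights ms)
    ss : ∀ {F} → Agree F F₀ → Semistandard F
    ss = FromHeights.tableau-semistandard hs
    within : ∀ {u} → u ∈ allCells → Within (at F₀ u)
    within {a , r , c} u∈ with ∈-allCells⁻ u∈
    ... | (1≤r , r≤p) , d , d< , refl = Semistandard.≥1 ss₀ a r d 1≤r r≤p d< , Semistandard.≤n ss₀ a r d 1≤r r≤p d<
      where
      ss₀ : Semistandard F₀
      ss₀ = ss (λ _ _ _ _ _ _ → refl)
    disagree : ∀ {F} → F ∈ all-fillings → ∀ {u} → u ∈ allCells → at F u ≢ at F₀ u → fiber ms F ≈ 0#
    disagree {F} F∈ {a , r , c} u∈ neq = fiber-vanishes ms λ e s → ⊥-elim (absurd e s (∈-allCells⁻ u∈))
      where
      absurd : confOf F ≡ ms → T (semistandard F) → (1 ≤ r × r ≤ p a) × (∃ λ d → d < size a r × c ≡ suc (part (γ a) r + d)) → ⊥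
      absurd refl s ((1≤r , r≤p) , d , d< , refl) = neq (agree-confOf {F} (semistandard⇒ F (inRange F∈) s) a r d 1≤r r≤p d<)
    value : ∀ {F} → F ∈ all-fillings → (∀ {u} → u ∈ allCells → at F u ≡ at F₀ u) → fiber ms F ≈ confWeight ms
    value {F} F∈ eq with confOf F ≟ᶜ ms
    ... | no neq = ⊥-elim (neq (confOf-tableau {F = F} len lens hs (agree-cells eq)))
    ... | yes e  = ≈-trans (tableauWeight-conf F∈ (semistandard⇐ F (ss {F} (agree-cells eq)))) (≈-reflexive (cong confWeight e))

  lattice≈LLT : latticeZ t spectral bottom top ≈ LLTpoly
  lattice≈LLT = begin
    latticeZ t spectral bottom top
      ≈⟨ latticeZ-chains t spectral bottom top ⟩
    Σ′ (chains k (length bottom) (length spectral)) confWeight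
      ≡⟨ cong₂ (λ w m → Σ′ (chains k w m) confWeight) (length-applyUpTo _ W) (length-applyUpTo _ n) ⟩
    Σ′ (chains k W n) confWeight
      ≈⟨ Σ-cong (chains k W n) fiber-total ⟨
    Σ′ (chains k W n) (λ ms → Σ′ all-fillings (fiber ms))
      ≈⟨ Σ-swap (chains k W n) all-fillings fiber ⟩
    Σ′ all-fillings (λ F → Σ′ (chains k W n) (λ ms → fiber ms F))
      ≈⟨ Σ-cong all-fillings (λ {F} _ → onlyConf F) ⟩
    Σ′ all-fillings tableauWeight
      ≈⟨ sumFill-fillings allCells tableauWeight emptyFilling ⟨
    LLTpoly ∎
    where
    onlyConf : ∀ F → Σ′ (chains k W n) (λ ms → fiber ms F) ≈ tableauWeight F
    onlyConf F = ≈-trans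
      (Σ-single (chains-unique k W n)
        (subst (λ m → confOf F ∈ chains k W m) (length-applyUpTo _ n) (∈-chains W (confOf F) (confOf-length F)))
        (λ {ms} _ ms≢ → ≈-reflexive (cong (λ b → if b then tableauWeight F else 0#)
          (trans (isYes≗does (confOf F ≟ᶜ ms)) (dec-false (confOf F ≟ᶜ ms) (ms≢ ∘ sym))))))
      (≈-reflexive (cong (λ b → if b then tableauWeight F else 0#)
        (trans (isYes≗does (confOf F ≟ᶜ confOf F)) (dec-true (confOf F ≟ᶜ confOf F) refl))))

part-antitone : ∀ {xs} → Linked _≥_ xs → ∀ r → 1 ≤ r → part xs (suc r) ≤ part xs r
part-antitone []       (suc r)       _ = z≤n
part-antitone [-]      (suc r)       _ = z≤n
part-antitone (ge ∷ l) 1             _ = ge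
part-antitone (ge ∷ l) (suc (suc r)) _ = part-antitone l (suc r) (s≤s z≤n)

part-mono : ∀ {xs ys} → Pointwise _≤_ xs ys → ∀ r → part xs r ≤ part ys r
part-mono []        r             = z≤n
part-mono (le ∷ pw) zero          = z≤n
part-mono (le ∷ pw) (suc zero)    = le
part-mono (le ∷ pw) (suc (suc r)) = part-mono pw (suc r)

foldr-⊓-≤ : ∀ {x z} xs → x ∈ z ∷ xs → foldr ℤ._⊓_ z xs ℤ.≤ x
foldr-⊓-≤ []       (here refl)         = ℤ.≤-refl
foldr-⊓-≤ (y ∷ xs) (here refl)         = ℤ.≤-trans (ℤ.i⊓j≤j y _) (foldr-⊓-≤ xs (here refl))
foldr-⊓-≤ (y ∷ xs) (there (here refl)) = ℤ.i⊓j≤i y _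
foldr-⊓-≤ (y ∷ xs) (there (there x∈))  = ℤ.≤-trans (ℤ.i⊓j≤j y _) (foldr-⊓-≤ xs (there x∈))

foldr-⊔-≥ : ∀ {x z} xs → x ∈ z ∷ xs → x ℤ.≤ foldr ℤ._⊔_ z xs
foldr-⊔-≥ []       (here refl)         = ℤ.≤-refl
foldr-⊔-≥ (y ∷ xs) (here refl)         = ℤ.≤-trans (foldr-⊔-≥ xs (here refl)) (ℤ.i≤j⊔i y _)
foldr-⊔-≥ (y ∷ xs) (there (here refl)) = ℤ.i≤i⊔j y _
foldr-⊔-≥ (y ∷ xs) (there (there x∈))  = ℤ.≤-trans (foldr-⊔-≥ xs (there x∈)) (ℤ.i≤j⊔i y _)

asDifference : ∀ i → ∃ λ P → ∃ λ Q → i ≡ pos P ℤ.- pos Q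
asDifference (pos m)    = m , 0 , sym (ℤ.+-identityʳ (pos m))
asDifference (negsuc m) = 0 , suc m , refl

anyL-cong : ∀ {A : Set} {f g : A → Bool} xs → (∀ {x} → x ∈ xs → f x ≡ g x) → anyL f xs ≡ anyL g xs
anyL-cong []       eq = refl
anyL-cong (x ∷ xs) eq = cong₂ _∨_ (eq (here refl)) (anyL-cong xs (eq ∘ there))

i+[j-i]≡j : ∀ i j → i ℤ.+ (j ℤ.- i) ≡ j
i+[j-i]≡j i j = trans (cong (λ z → i ℤ.+ z) (ℤ.+-comm j (ℤ.- i)))
  (trans (sym (ℤ.+-assoc i (ℤ.- i) j)) (trans (cong (λ z → z ℤ.+ j) (ℤ.+-inverseʳ i)) (ℤ.+-identityˡ j)))

module SkewTuple {k : ℕ} (β γ : Fin k → List ℕ)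
  (β-linked : ∀ a → Linked _≥_ (β a)) (γ-linked : ∀ a → Linked _≥_ (γ a)) (γ⊆β : ∀ a → Pointwise _≤_ (γ a) (β a)) where
  open Shape β γ

  particle : (Fin k → List ℕ) → Fin k → ℕ → ℤ
  particle μ a r = pos (part (μ a) r) ℤ.- pos r ℤ.+ pos 1

  ∈-positions : ∀ μ a r → 1 ≤ r → r ≤ length (μ a) → particle μ a r ∈ positions μ
  ∈-positions μ a r 1≤r r≤ = ∈-concatMap (λ a → map (particle μ a) (map suc (upTo (length (μ a))))) (∈-allFin a)
    (∈-map⁺ (particle μ a) (∈-rows⁺ 1≤r r≤))

  minℤ-≤ : ∀ {x} xs → x ∈ xs → minℤ xs ℤ.≤ x
  minℤ-≤ (y ∷ xs) = foldr-⊓-≤ xs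

  maxℤ-≥ : ∀ {x} xs → x ∈ xs → x ℤ.≤ maxℤ xs
  maxℤ-≥ (y ∷ xs) = foldr-⊔-≥ xs

  length-γ : ∀ a → length (γ a) ≡ p a
  length-γ a = Pointwise-length (γ⊆β a)

  rmin≤γ : ∀ a r → 1 ≤ r → r ≤ p a → rmin ℤ.≤ particle γ a r
  rmin≤γ a r 1≤r r≤p = minℤ-≤ (positions γ) (∈-positions γ a r 1≤r (subst (r ≤_) (sym (length-γ a)) r≤p))

  particle-γ≤β : ∀ a r → particle γ a r ℤ.≤ particle β a r
  particle-γ≤β a r = ℤ.+-monoˡ-≤ (pos 1) (ℤ.+-monoˡ-≤ (ℤ.- pos r) (ℤ.+≤+ (part-mono (γ⊆β a) r)))

  rmin≤β : ∀ a r → 1 ≤ r → r ≤ p a → rmin ℤ.≤ particle β a r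
  rmin≤β a r 1≤r r≤p = ℤ.≤-trans (rmin≤γ a r 1≤r r≤p) (particle-γ≤β a r)

  offset : (Fin k → List ℕ) → Fin k → ℕ → ℕ
  offset μ a r = ℤ.∣ particle μ a r ℤ.- rmin ∣

  offset-particle : ∀ μ a r → rmin ℤ.≤ particle μ a r → rmin ℤ.+ pos (offset μ a r) ≡ particle μ a r
  offset-particle μ a r le = trans (cong (λ z → rmin ℤ.+ z) (ℤ.0≤i⇒+∣i∣≡i (ℤ.i≤j⇒0≤j-i le))) (i+[j-i]≡j rmin _)

  P₀ Q₀ : ℕ
  P₀ = proj₁ (asDifference rmin)
  Q₀ = proj₁ (proj₂ (asDifference rmin))

  offset-shift : ∀ μ a r → rmin ℤ.≤ particle μ a r → offset μ a r + (r + P₀) ≡ part (μ a) r + suc Q₀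
  offset-shift μ a r le = begin
    g + (r + P₀)              ≡⟨ +-comm g (r + P₀) ⟩
    r + P₀ + g                ≡⟨ +-assoc r P₀ g ⟩
    r + (P₀ + g)              ≡⟨ +-comm r (P₀ + g) ⟩
    P₀ + g + r                ≡⟨ ⊖-injective (P₀ + g) Q₀ (suc (part (μ a) r)) r difference ⟩
    suc (part (μ a) r) + Q₀   ≡⟨ +-suc (part (μ a) r) Q₀ ⟨
    part (μ a) r + suc Q₀     ∎
    where
    open ≡-Reasoning
    g = offset μ a r
    swapʳ : ∀ i j l → i ℤ.+ j ℤ.+ l ≡ i ℤ.+ l ℤ.+ j
    swapʳ i j l = trans (ℤ.+-assoc i j l) (trans (cong (λ z → i ℤ.+ z) (ℤ.+-comm j l)) (sym (ℤ.+-assoc i l j)))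
    difference : pos (P₀ + g) ℤ.- pos Q₀ ≡ pos (suc (part (μ a) r)) ℤ.- pos r
    difference = begin
      pos (P₀ + g) ℤ.- pos Q₀                 ≡⟨ cong (λ z → z ℤ.- pos Q₀) (ℤ.pos-+ P₀ g) ⟩
      pos P₀ ℤ.+ pos g ℤ.- pos Q₀             ≡⟨ swapʳ (pos P₀) (pos g) (ℤ.- pos Q₀) ⟩
      pos P₀ ℤ.- pos Q₀ ℤ.+ pos g             ≡⟨ cong (λ z → z ℤ.+ pos g) (proj₂ (proj₂ (asDifference rmin))) ⟨
      rmin ℤ.+ pos g                          ≡⟨ offset-particle μ a r le ⟩
      pos (part (μ a) r) ℤ.- pos r ℤ.+ pos 1  ≡⟨ swapʳ (pos (part (μ a) r)) (ℤ.- pos r) (pos 1) ⟩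
      pos (part (μ a) r) ℤ.+ pos 1 ℤ.- pos r  ≡⟨ cong (λ z → pos z ℤ.- pos r) (+-comm (part (μ a) r) 1) ⟩
      pos (suc (part (μ a) r)) ℤ.- pos r      ∎

  width : ℕ
  width = suc ℤ.∣ smax ℤ.- rmin ∣

  offset<width : ∀ a r → 1 ≤ r → r ≤ p a → offset β a r < width
  offset<width a r 1≤r r≤p = s≤s (ℤ.drop‿+≤+ (subst₂ ℤ._≤_
    (sym (ℤ.0≤i⇒+∣i∣≡i (ℤ.i≤j⇒0≤j-i low)))
    (sym (ℤ.0≤i⇒+∣i∣≡i (ℤ.i≤j⇒0≤j-i (ℤ.≤-trans low high))))
    (ℤ.+-monoˡ-≤ (ℤ.- rmin) high)))
    where
    low = rmin≤β a r 1≤r r≤p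
    high : particle β a r ℤ.≤ smax
    high = maxℤ-≥ (positions β) (∈-positions β a r 1≤r r≤p)

  coordinates : Coordinates β γ
  coordinates = record
    { G = offset γ
    ; B = offset β
    ; P = P₀
    ; Q = suc Q₀
    ; W = width
    ; G-shift = λ a r 1≤r r≤p → offset-shift γ a r (rmin≤γ a r 1≤r r≤p)
    ; B-shift = λ a r 1≤r r≤p → offset-shift β a r (rmin≤β a r 1≤r r≤p)
    ; γ≤β = λ a r _ _ → part-mono (γ⊆β a) r
    ; γ-antitone = λ a r 1≤r _ → part-antitone (γ-linked a) r 1≤r
    ; β-antitone = λ a r 1≤r _ → part-antitone (β-linked a) r 1≤r
    ; B<W = offset<width
    }

  boundary : ∀ μ → (∀ a → length (μ a) ≡ p a) → (∀ a r → 1 ≤ r → r ≤ p a → rmin ℤ.≤ particle μ a r) →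
    map (label μ) columns ≡ applyUpTo (λ i → tabulate (λ a → anyL (λ r → i ≡ᵇ offset μ a r) (rows a))) width
  boundary μ len le = trans (sym (map-∘ (upTo width))) (trans (map-cong entry (upTo width)) (map-upTo _ width))
    where
    entry : ∀ i → label μ (rmin ℤ.+ pos i) ≡ tabulate (λ a → anyL (λ r → i ≡ᵇ offset μ a r) (rows a))
    entry i = tabulate-cong λ a → trans
      (cong (λ m → anyL (λ r → ⌊ rmin ℤ.+ pos i ℤ.≟ particle μ a r ⌋) (map suc (upTo m))) (len a))
      (anyL-cong (rows a) λ {r} r∈ → hit a r (proj₁ (∈-rows⁻ r∈)) (proj₂ (∈-rows⁻ r∈)))
      where
      hit : ∀ a r → 1 ≤ r → r ≤ p a → ⌊ rmin ℤ.+ pos i ℤ.≟ particle μ a r ⌋ ≡ (i ≡ᵇ offset μ a r)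
      hit a r 1≤r r≤p with rmin ℤ.+ pos i ℤ.≟ particle μ a r | offset-particle μ a r (le a r 1≤r r≤p)
      ... | yes eq | off = sym (T⇒≡true (≡⇒≡ᵇ i _ (ℤ.+-injective (ℤ-+-cancelˡ rmin (pos i) _ (trans eq (sym off))))))
      ... | no neq | off = sym (¬T⇒≡false λ t → neq (trans (cong (λ m → rmin ℤ.+ pos m) (≡ᵇ⇒≡ i _ t)) off))

module _ {c ℓ : Level} (R : CommutativeSemiring c ℓ) where
  open CommutativeSemiring R using (Carrier)
  open Weights R

  xAt-toℕ : ∀ {n} (x : Fin n → Carrier) i → xAt x (suc (toℕ i)) ≡ x i
  xAt-toℕ {n} x i with toℕ i <? n
  ... | yes lt = cong x (fromℕ<-toℕ i lt)
  ... | no nlt = ⊥-elim (nlt (toℕ<n i))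

  tabulate≡applyUpTo : ∀ {A : Set c} {n} (f : Fin n → A) (g : ℕ → A) → (∀ i → f i ≡ g (toℕ i)) → List.tabulate f ≡ applyUpTo g n
  tabulate≡applyUpTo {n = zero}  f g eq = refl
  tabulate≡applyUpTo {n = suc n} f g eq = cong₂ _∷_ (eq zero) (tabulate≡applyUpTo (f ∘ suc) (g ∘ suc) (eq ∘ suc))

  spectral≡ : ∀ {n} (x : Fin n → Carrier) → map x (allFin n) ≡ applyUpTo (λ e → xAt x (suc e)) n
  spectral≡ x = trans (map-tabulate id x) (tabulate≡applyUpTo x _ (λ i → sym (xAt-toℕ x i)))

theorem3p4 : ∀ {c ℓ : Level} (R : CommutativeSemiring c ℓ) (k n : ℕ) → 1 ≤ k → 1 ≤ n →
    (β γ : Fin k → List ℕ) →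
    (∀ j → 1 ≤ length (β j)) →
    (∀ j → Linked _≥_ (β j)) → (∀ j → Linked _≥_ (γ j)) →
    (∀ j → Pointwise _≤_ (γ j) (β j)) →
    (x : Fin n → CommutativeSemiring.Carrier R) → (t : CommutativeSemiring.Carrier R) →
    CommutativeSemiring._≈_ R (Weights.partitionFunction R β γ x t) (Weights.coinvLLT R β γ x t)
theorem3p4 R k n _ 1≤n β γ _ β-linked γ-linked γ⊆β x t = begin
  latticeZ t (map x (allFin n)) bottomBoundary topBoundary
    ≡⟨ cong (λ xs → latticeZ t xs bottomBoundary topBoundary) (spectral≡ R x) ⟩
  latticeZ t spectral bottomBoundary topBoundary
    ≡⟨ cong₂ (latticeZ t spectral) (boundary γ length-γ rmin≤γ) (boundary β (λ _ → refl) rmin≤β) ⟩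
  latticeZ t spectral bottom top
    ≈⟨ lattice≈LLT ⟩
  coinvLLT β γ x t ∎
  where
  open Weights R
  open SkewTuple β γ β-linked γ-linked γ⊆β
  open Shape β γ using (bottomBoundary; topBoundary)
  open Bijection coordinates n 1≤n using (bottom; top)
  open Equality R coordinates 1≤n x t using (spectral; lattice≈LLT)
  open import Relation.Binary.Reasoning.Setoid (CommutativeSemiring.setoid R)
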